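{- For every constant $c>0$ there exist constants $C,d>0$ and $n_0$ such that for every $n\ge n_0$ and every $f:\{0,1\}^n\to\{0,1\}$ that depends on all of its $n$ input variables and satisfies $\mathsf{alt}(f)\le(\log_2 n)^c$, we have $$\mathsf{CC}_\oplus(f)\le C\,(1+\log_2\mathsf{sparsity}(f))^d,$$ i.e. the XOR Log-Rank Conjecture holds for such $f$.
   Context: $\mathsf{alt}(f)$ (alternation): for $x\prec y$ meaning $x_i\le y_i$ for all $i$, a chain is a sequence of distinct inputs $0^n=x_0\prec\dots\prec x_n=1^n$; $\mathsf{alt}(f)$ is the maximum over chains of the number of $i$ with $f(x_{i-1})\ne f(x_i)$. $\mathsf{CC}_\oplus(f)$ is the deterministic two-party communication complexity of $F(x,y)=f(x\oplus y)$, where Alice holds $x\in\{0,1\}^n$ and Bob holds $y\in\{0,1\}^n$. $\mathsf{sparsity}(f)$ is the number of nonzero Fourier coefficients of $1-2f$ (Fourier expansion in the characters $\chi_S(x)=(-1)^{\sum_{i\in S}x_i}$). The XOR Log-Rank Conjecture asserts $\mathsf{CC}_\oplus(f)$ is bounded by a polynomial in $\log\mathsf{sparsity}(f)$. -}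

module Defs where

open import Data.Nat using (ℕ; zero; suc; _+_; _*_; _^_; _≤_; _<_)
open import Data.Bool using (Bool; true; false; _xor_; not; if_then_else_; _∧_; _≤_)
open import Data.Integer as ℤ using (ℤ)
open import Data.Fin using (Fin; zero; suc; inject₁; fromℕ)
open import Data.Vec using (Vec; []; _∷_; replicate; zipWith; updateAt; lookup; foldr)
open import Data.List as List using (List; []; _∷_; _++_; length; filter; allFin)
open import Data.Nat.ListAction using (sum)
open import Data.Product using (Σ; ∃; _×_; _,_)
open import Relation.Binary.PropositionalEquality using (_≡_; _≢_)
open import Relation.Nullary using (¬_)
open import Relation.Nullary.Decidable using (¬?)

Cube : ℕ → Set
Cube n = Vec Bool n

BoolFun : ℕ → Set
BoolFun n = Cube n → Bool

allCube : (n : ℕ) → List (Cube n)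
allCube zero = [] ∷ []
allCube (suc n) = List.map (false ∷_) (allCube n) ++ List.map (true ∷_) (allCube n)

flipAt : ∀ {n} → Fin n → Cube n → Cube n
flipAt i x = updateAt x i not

DependsOnAll : ∀ {n} → BoolFun n → Set
DependsOnAll {n} f = (i : Fin n) → ∃ λ (x : Cube n) → f x ≢ f (flipAt i x)

_≼_ : ∀ {n} → Cube n → Cube n → Set
x ≼ y = ∀ i → lookup x i Data.Bool.≤ lookup y i

record Chain (n : ℕ) : Set where
  field
    pt      : Fin (suc n) → Cube n
    start   : pt zero ≡ replicate n false
    end     : pt (fromℕ n) ≡ replicate n true
    step-≼  : (i : Fin n) → pt (inject₁ i) ≼ pt (suc i)
    step-≢  : (i : Fin n) → pt (inject₁ i) ≢ pt (suc i)
open Chain public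

sumFin : ∀ {n} → (Fin n → ℕ) → ℕ
sumFin {n} g = sum (List.map g (allFin n))

switches : ∀ {n} → BoolFun n → Chain n → ℕ
switches {n} f ch =
  sumFin (λ (i : Fin n) → if f (pt ch (inject₁ i)) xor f (pt ch (suc i)) then 1 else 0)

-- alt(f) ≤ k  (alt is the maximum of `switches` over all chains)
AltAtMost : ∀ {n} → BoolFun n → ℕ → Set
AltAtMost {n} f k = (ch : Chain n) → switches f ch Data.Nat.≤ k

sign : Bool → ℤ
sign false = ℤ.1ℤ
sign true  = ℤ.-1ℤ

dotParity : ∀ {n} → Cube n → Cube n → Bool
dotParity S x = foldr _ _xor_ false (zipWith _∧_ S x)

-- 2^n · \hat{(1-2f)}(S) = Σ_x (1 - 2 f(x)) χ_S(x)
fourierNum : ∀ {n} → BoolFun n → Cube n → ℤ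
fourierNum {n} f S =
  List.foldr ℤ._+_ ℤ.0ℤ (List.map (λ x → sign (f x) ℤ.* sign (dotParity S x)) (allCube n))

sparsity : ∀ {n} → BoolFun n → ℕ
sparsity {n} f = length (filter (λ S → ¬? (fourierNum f S ℤ.≟ ℤ.0ℤ)) (allCube n))

data Protocol (n : ℕ) : Set where
  leaf  : Bool → Protocol n
  alice : (Cube n → Bool) → Protocol n → Protocol n → Protocol n
  bob   : (Cube n → Bool) → Protocol n → Protocol n → Protocol n

run : ∀ {n} → Protocol n → Cube n → Cube n → Bool
run (leaf b) x y = b
run (alice m l r) x y = if m x then run r x y else run l x y
run (bob m l r) x y = if m y then run r x y else run l x y

depth : ∀ {n} → Protocol n → ℕ
depth (leaf _) = 0
depth (alice _ l r) = suc (depth l Data.Nat.⊔ depth r)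
depth (bob _ l r) = suc (depth l Data.Nat.⊔ depth r)

xorVec : ∀ {n} → Cube n → Cube n → Cube n
xorVec = zipWith _xor_

XorCCAtMost : ∀ {n} → BoolFun n → ℕ → Set
XorCCAtMost {n} f k =
  Σ (Protocol n) λ P → depth P Data.Nat.≤ k × (∀ x y → run P x y ≡ f (xorVec x y))

{-# OPTIONS --safe #-}

-- Write s for the sparsity of f and K for its alternation.
--
-- Lower bound on s. Modulo the kernel of f (the vectors on which all characters in the support of
-- 1 - 2f are trivial) the cube has dimension at most s. If n > (K + 2) s, one can peel off K + 2
-- disjoint sets of coordinates, each spanning all coordinates left after the previous ones. The
-- first set reaches, modulo the kernel, a point sensitive at a left-over coordinate i, and each
-- other set contains a representative of e_i; adding these one at a time gives K + 1 alternations.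
-- Hence n ≤ (K + 2) s, and if K is polylogarithmic in n then log n = O(1 + log s).
--
-- Upper bound on communication. The 𝔽₂-degree d of f is at most 1 + log s. Climbing from 0 through
-- minimal points where f changes, at most K d coordinates set to true make f constant. Querying
-- them lowers the degree whatever the answers, so d such rounds give a decision tree of height
-- at most K d² for f.

module Submission where

open import Defs
open import Algebra.Bundles using (module CommutativeRing)
open import Data.Bool as Bool using (Bool; true; false; _xor_; not; _∧_; if_then_else_; b≤b; f≤t)
open import Data.Bool.Properties as Boolₚ
  using (xor-assoc; xor-comm; xor-same; xor-identityʳ; ∧-distribˡ-xor; xor-∧-commutativeRing)
open import Data.Fin using (Fin; zero; suc; inject₁; fromℕ)
import Data.Fin.Properties as Finₚ
open import Data.Integer as ℤ using (ℤ; -[1+_]; 0ℤ; 1ℤ; -1ℤ)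
import Data.Integer.Properties as ℤₚ
open import Data.Integer.Tactic.RingSolver using (solve-∀)
open import Data.List as List using (List; []; _∷_; _++_; length; filter)
open import Data.List.Membership.Propositional using (_∈_)
open import Data.List.Membership.Propositional.Properties using (∈-++⁺ˡ; ∈-++⁺ʳ; ∈-map⁺; ∈-filter⁺)
import Data.List.Properties as Listₚ
open import Data.List.Relation.Unary.All as All using (All; []; _∷_)
open import Data.List.Relation.Unary.Any using (here)
open import Data.Maybe using (Maybe; just; nothing)
open import Data.Nat
  using (ℕ; zero; suc; _+_; _*_; _^_; _≤_; _<_; _⊔_; _/_; _%_; z≤n; s≤s; NonZero; >-nonZero)
open import Data.Nat.DivMod using (m≡m%n+[m/n]*n; m%n<n)
open import Data.Nat.Logarithm
  using (⌊log₂_⌋; ⌈log₂_⌉; ⌊log₂⌋-mono-≤; ⌊log₂[2^n]⌋≡n; ⌈log₂⌉-mono-≤; ⌈log₂2^n⌉≡n)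
import Data.Nat.Properties as ℕₚ
open import Data.Nat.Tactic.RingSolver renaming (solve-∀ to ℕ-solve-∀)
open import Data.Product using (Σ; ∃; _×_; _,_; proj₁; proj₂)
open import Data.Sum using (_⊎_; inj₁; inj₂)
open import Data.Vec using (Vec; []; _∷_; lookup; map; replicate; zipWith; _[_]≔_)
import Data.Vec.Properties as Vecₚ
open import Data.Vec.Relation.Binary.Pointwise.Inductive as Pointwise using (Pointwise; []; _∷_)
open import Function using (_∘_; id)
open import Relation.Binary.PropositionalEquality
open import Relation.Nullary using (Dec; yes; no; contradiction)
open import Relation.Nullary.Decidable using (¬?; _×-dec_; decidable-stable)

open import Algebra.Properties.CommutativeSemigroup ℕₚ.+-commutativeSemigroup
  using () renaming (interchange to +-interchange)
open import Algebra.Properties.CommutativeSemigroup ℕₚ.*-commutativeSemigroup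
  using () renaming (interchange to *-interchange)
open import Algebra.Properties.CommutativeSemigroup
  (CommutativeRing.+-commutativeSemigroup xor-∧-commutativeRing)
  using () renaming (interchange to xor-interchange)

-- Fourier coefficients and sparsity

_⊞ : ∀ {n} → (Cube (suc n) → ℤ) → Cube n → ℤ
(g ⊞) x = g (false ∷ x) ℤ.+ g (true ∷ x)

_⊟ : ∀ {n} → (Cube (suc n) → ℤ) → Cube n → ℤ
(g ⊟) x = g (false ∷ x) ℤ.- g (true ∷ x)

-- The unnormalised Walsh-Hadamard transform, taken one coordinate at a time: characters without the
-- first coordinate see only `g ⊞`, those with it only `g ⊟`. Inductions can then split the spectrum
-- in two.
hat : ∀ {n} → (Cube n → ℤ) → Cube n → ℤ
hat g []          = g []
hat g (false ∷ S) = hat (g ⊞) S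
hat g (true ∷ S)  = hat (g ⊟) S

cubeSum : ∀ {n} → (Cube n → ℤ) → ℤ
cubeSum {n} h = List.foldr ℤ._+_ 0ℤ (List.map h (allCube n))

cubeSum-cong : ∀ {n} {g h : Cube n → ℤ} → g ≗ h → cubeSum g ≡ cubeSum h
cubeSum-cong {n} g≗h = cong (List.foldr ℤ._+_ 0ℤ) (Listₚ.map-cong g≗h (allCube n))

foldr-+-++ : ∀ (xs ys : List ℤ) →
  List.foldr ℤ._+_ 0ℤ (xs ++ ys) ≡ List.foldr ℤ._+_ 0ℤ xs ℤ.+ List.foldr ℤ._+_ 0ℤ ys
foldr-+-++ []       ys = sym (ℤₚ.+-identityˡ _)
foldr-+-++ (x ∷ xs) ys = trans (cong (λ z → x ℤ.+ z) (foldr-+-++ xs ys)) (sym (ℤₚ.+-assoc x _ _))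

cubeSum-suc : ∀ {n} (h : Cube (suc n) → ℤ) →
  cubeSum h ≡ cubeSum (h ∘ (false ∷_)) ℤ.+ cubeSum (h ∘ (true ∷_))
cubeSum-suc {n} h = begin
  total (List.map h (F ++ T))              ≡⟨ cong total (Listₚ.map-++ h F T) ⟩
  total (List.map h F ++ List.map h T)     ≡⟨ foldr-+-++ (List.map h F) (List.map h T) ⟩
  total (List.map h F) ℤ.+ total (List.map h T)
    ≡⟨ cong₂ (λ xs ys → total xs ℤ.+ total ys) (Listₚ.map-∘ (allCube n)) (Listₚ.map-∘ (allCube n)) ⟨
  cubeSum (h ∘ (false ∷_)) ℤ.+ cubeSum (h ∘ (true ∷_)) ∎
  where
  open ≡-Reasoning
  total = List.foldr ℤ._+_ 0ℤ
  F = List.map (false ∷_) (allCube n)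
  T = List.map (true ∷_) (allCube n)

cubeSum-+ : ∀ {n} (g h : Cube n → ℤ) → cubeSum (λ x → g x ℤ.+ h x) ≡ cubeSum g ℤ.+ cubeSum h
cubeSum-+ {n} g h = go (allCube n)
  where
  go : ∀ xs → List.foldr ℤ._+_ 0ℤ (List.map (λ x → g x ℤ.+ h x) xs) ≡
    List.foldr ℤ._+_ 0ℤ (List.map g xs) ℤ.+ List.foldr ℤ._+_ 0ℤ (List.map h xs)
  go []       = refl
  go (x ∷ xs) = trans (cong (λ z → g x ℤ.+ h x ℤ.+ z) (go xs)) (swap (g x) (h x) _ _)
    where
    swap : ∀ a b c d → a ℤ.+ b ℤ.+ (c ℤ.+ d) ≡ a ℤ.+ c ℤ.+ (b ℤ.+ d)
    swap = solve-∀

sign-not : ∀ b → sign (not b) ≡ ℤ.- sign b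
sign-not false = refl
sign-not true  = refl

hat-cubeSum : ∀ {n} (g : Cube n → ℤ) S → cubeSum (λ x → g x ℤ.* sign (dotParity S x)) ≡ hat g S
hat-cubeSum g [] = trans (ℤₚ.+-identityʳ _) (ℤₚ.*-identityʳ _)
hat-cubeSum {suc n} g (false ∷ S) = begin
  cubeSum {suc n} (λ x → g x ℤ.* sign (dotParity (false ∷ S) x))
    ≡⟨ cubeSum-suc (λ x → g x ℤ.* sign (dotParity (false ∷ S) x)) ⟩
  cubeSum {n} (λ x → g (false ∷ x) ℤ.* χ x) ℤ.+ cubeSum {n} (λ x → g (true ∷ x) ℤ.* χ x)
    ≡⟨ cubeSum-+ {n} (λ x → g (false ∷ x) ℤ.* χ x) (λ x → g (true ∷ x) ℤ.* χ x) ⟨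
  cubeSum {n} (λ x → g (false ∷ x) ℤ.* χ x ℤ.+ g (true ∷ x) ℤ.* χ x)
    ≡⟨ cubeSum-cong (λ x → ℤₚ.*-distribʳ-+ (χ x) (g (false ∷ x)) (g (true ∷ x))) ⟨
  cubeSum (λ x → (g ⊞) x ℤ.* χ x)
    ≡⟨ hat-cubeSum (g ⊞) S ⟩
  hat (g ⊞) S ∎
  where
  open ≡-Reasoning
  χ : Cube n → ℤ
  χ x = sign (dotParity S x)
hat-cubeSum {suc n} g (true ∷ S) = begin
  cubeSum {suc n} (λ x → g x ℤ.* sign (dotParity (true ∷ S) x))
    ≡⟨ cubeSum-suc (λ x → g x ℤ.* sign (dotParity (true ∷ S) x)) ⟩
  cubeSum {n} (λ x → g (false ∷ x) ℤ.* χ x) ℤ.+ cubeSum {n} (λ x → g (true ∷ x) ℤ.* χ̄ x)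
    ≡⟨ cubeSum-+ {n} (λ x → g (false ∷ x) ℤ.* χ x) (λ x → g (true ∷ x) ℤ.* χ̄ x) ⟨
  cubeSum {n} (λ x → g (false ∷ x) ℤ.* χ x ℤ.+ g (true ∷ x) ℤ.* χ̄ x)
    ≡⟨ cubeSum-cong difference ⟩
  cubeSum (λ x → (g ⊟) x ℤ.* χ x)
    ≡⟨ hat-cubeSum (g ⊟) S ⟩
  hat (g ⊟) S ∎
  where
  open ≡-Reasoning
  χ χ̄ : Cube n → ℤ
  χ x = sign (dotParity S x)
  χ̄ x = sign (not (dotParity S x))
  factor : ∀ a b s → a ℤ.* s ℤ.+ b ℤ.* (ℤ.- s) ≡ (a ℤ.- b) ℤ.* s
  factor = solve-∀
  difference : ∀ x → g (false ∷ x) ℤ.* χ x ℤ.+ g (true ∷ x) ℤ.* χ̄ x ≡ (g ⊟) x ℤ.* χ x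
  difference x rewrite sign-not (dotParity S x) = factor (g (false ∷ x)) (g (true ∷ x)) (χ x)

fourierNum-hat : ∀ {n} (f : BoolFun n) S → fourierNum f S ≡ hat (sign ∘ f) S
fourierNum-hat f = hat-cubeSum (sign ∘ f)

nonzero : ℤ → ℕ
nonzero z = length (filter (λ a → ¬? (a ℤ.≟ 0ℤ)) (z ∷ []))

-- The size of the support of `hat g`. It is set up for integer-valued functions because `⊞` and `⊟`
-- do not preserve values in ±1.
spars : ∀ {n} → (Cube n → ℤ) → ℕ
spars {zero}  g = nonzero (g [])
spars {suc n} g = spars (g ⊞) + spars (g ⊟)

count : ∀ {A : Set} → (A → ℤ) → List A → ℕ
count h xs = length (filter (λ x → ¬? (h x ℤ.≟ 0ℤ)) xs)

count-∷ : ∀ {A : Set} (h : A → ℤ) x xs → count h (x ∷ xs) ≡ nonzero (h x) + count h xs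
count-∷ h x xs with h x ℤ.≟ 0ℤ
... | yes _ = refl
... | no  _ = refl

count-map : ∀ {A B : Set} (h : B → ℤ) (k : A → B) xs → count h (List.map k xs) ≡ count (h ∘ k) xs
count-map h k []       = refl
count-map h k (x ∷ xs) = begin
  count h (k x ∷ List.map k xs)                  ≡⟨ count-∷ h (k x) _ ⟩
  nonzero (h (k x)) + count h (List.map k xs)    ≡⟨ cong (_ +_) (count-map h k xs) ⟩
  nonzero (h (k x)) + count (h ∘ k) xs           ≡⟨ count-∷ (h ∘ k) x xs ⟨
  count (h ∘ k) (x ∷ xs)                         ∎
  where open ≡-Reasoning

count-cong : ∀ {A : Set} {g h : A → ℤ} → g ≗ h → ∀ xs → count g xs ≡ count h xs
count-cong         g≗h []       = refl
count-cong {g = g} {h} g≗h (x ∷ xs) = begin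
  count g (x ∷ xs)              ≡⟨ count-∷ g x xs ⟩
  nonzero (g x) + count g xs    ≡⟨ cong₂ _+_ (cong nonzero (g≗h x)) (count-cong g≗h xs) ⟩
  nonzero (h x) + count h xs    ≡⟨ count-∷ h x xs ⟨
  count h (x ∷ xs)              ∎
  where open ≡-Reasoning

count-++ : ∀ {A : Set} (h : A → ℤ) xs ys → count h (xs ++ ys) ≡ count h xs + count h ys
count-++ h xs ys = trans (cong length (Listₚ.filter-++ _ xs ys)) (Listₚ.length-++ (filter _ xs))

count-hat : ∀ {n} (g : Cube n → ℤ) → count (hat g) (allCube n) ≡ spars g
count-hat {zero}  g = trans (count-∷ (hat g) [] []) (ℕₚ.+-identityʳ _)
count-hat {suc n} g = begin
  count (hat g) (allCube (suc n))                              ≡⟨ count-++ (hat g) (List.map (false ∷_) (allCube n)) _ ⟩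
  count (hat g) (List.map (false ∷_) (allCube n)) + count (hat g) (List.map (true ∷_) (allCube n))
    ≡⟨ cong₂ _+_ (count-map (hat g) (false ∷_) (allCube n)) (count-map (hat g) (true ∷_) (allCube n)) ⟩
  count (hat (g ⊞)) (allCube n) + count (hat (g ⊟)) (allCube n) ≡⟨ cong₂ _+_ (count-hat (g ⊞)) (count-hat (g ⊟)) ⟩
  spars g                                                      ∎
  where open ≡-Reasoning

sparsity-spars : ∀ {n} (f : BoolFun n) → sparsity f ≡ spars (sign ∘ f)
sparsity-spars {n} f = trans (count-cong (fourierNum-hat f) (allCube n)) (count-hat (sign ∘ f))

spars-cong : ∀ {n} {g h : Cube n → ℤ} → g ≗ h → spars g ≡ spars h
spars-cong {zero}  g≗h = cong nonzero (g≗h [])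
spars-cong {suc n} g≗h = cong₂ _+_
  (spars-cong (λ x → cong₂ ℤ._+_ (g≗h (false ∷ x)) (g≗h (true ∷ x))))
  (spars-cong (λ x → cong₂ ℤ._-_ (g≗h (false ∷ x)) (g≗h (true ∷ x))))

nonzero≤1 : ∀ a → nonzero a ≤ 1
nonzero≤1 a = Listₚ.length-filter (λ a → ¬? (a ℤ.≟ 0ℤ)) (a ∷ [])

nonzero-+ : ∀ a b → nonzero (a ℤ.+ b) ≤ nonzero a + nonzero b
nonzero-+ a b with a ℤ.≟ 0ℤ
... | yes refl = ℕₚ.≤-reflexive (cong nonzero (ℤₚ.+-identityˡ b))
... | no  _    = ℕₚ.≤-trans (nonzero≤1 (a ℤ.+ b)) (s≤s z≤n)

-- The transform is linear, so a coefficient of the sum vanishes wherever both summands have a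
-- vanishing coefficient.
spars-+ : ∀ {n} (g h : Cube n → ℤ) → spars (λ x → g x ℤ.+ h x) ≤ spars g + spars h
spars-+ {zero}  g h = nonzero-+ (g []) (h [])
spars-+ {suc n} g h = begin
  spars (λ x → g x ℤ.+ h x)
    ≡⟨ cong₂ _+_ (spars-cong (λ x → swap⁺ (g (false ∷ x)) (h (false ∷ x)) _ _))
                 (spars-cong (λ x → swap⁻ (g (false ∷ x)) (h (false ∷ x)) (g (true ∷ x)) (h (true ∷ x)))) ⟩
  spars (λ x → (g ⊞) x ℤ.+ (h ⊞) x) + spars (λ x → (g ⊟) x ℤ.+ (h ⊟) x)
    ≤⟨ ℕₚ.+-mono-≤ (spars-+ (g ⊞) (h ⊞)) (spars-+ (g ⊟) (h ⊟)) ⟩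
  (spars (g ⊞) + spars (h ⊞)) + (spars (g ⊟) + spars (h ⊟))
    ≡⟨ +-interchange (spars (g ⊞)) (spars (h ⊞)) _ _ ⟩
  spars g + spars h ∎
  where
  open ℕₚ.≤-Reasoning
  swap⁺ : ∀ a b c d → a ℤ.+ b ℤ.+ (c ℤ.+ d) ≡ a ℤ.+ c ℤ.+ (b ℤ.+ d)
  swap⁺ = solve-∀
  swap⁻ : ∀ a b c d → a ℤ.+ b ℤ.- (c ℤ.+ d) ≡ a ℤ.- c ℤ.+ (b ℤ.- d)
  swap⁻ = solve-∀

nonzero-* : ∀ k a → k ≢ 0ℤ → nonzero (k ℤ.* a) ≡ nonzero a
nonzero-* k a k≢0 with a ℤ.≟ 0ℤ
... | yes refl = cong nonzero (ℤₚ.*-zeroʳ k)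
... | no a≢0 with k ℤ.* a ℤ.≟ 0ℤ
...   | no _ = refl
...   | yes ka≡0 with ℤₚ.i*j≡0⇒i≡0∨j≡0 k ka≡0
...     | inj₁ k≡0 = contradiction k≡0 k≢0
...     | inj₂ a≡0 = contradiction a≡0 a≢0

spars-* : ∀ {n} k (g : Cube n → ℤ) → k ≢ 0ℤ → spars (λ x → k ℤ.* g x) ≡ spars g
spars-* {zero}  k g k≢0 = nonzero-* k (g []) k≢0
spars-* {suc n} k g k≢0 = cong₂ _+_
  (trans (spars-cong (λ x → sym (ℤₚ.*-distribˡ-+ k (g (false ∷ x)) (g (true ∷ x))))) (spars-* k (g ⊞) k≢0))
  (trans (spars-cong (λ x → factor k (g (false ∷ x)) (g (true ∷ x)))) (spars-* k (g ⊟) k≢0))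
  where
  factor : ∀ k a b → k ℤ.* a ℤ.- k ℤ.* b ≡ k ℤ.* (a ℤ.- b)
  factor = solve-∀

spars-0 : ∀ n → spars {n} (λ _ → 0ℤ) ≡ 0
spars-0 zero    = refl
spars-0 (suc n) = cong₂ _+_ (spars-0 n) (spars-0 n)

-- Only the trivial character can survive: at every coordinate the difference half is identically
-- zero.
spars-const : ∀ n c → spars {n} (λ _ → c) ≤ 1
spars-const zero    c = nonzero≤1 c
spars-const (suc n) c = begin
  spars {n} (λ _ → c ℤ.+ c) + spars {n} (λ _ → c ℤ.- c)
    ≡⟨ cong (spars {n} (λ _ → c ℤ.+ c) +_) (trans (spars-cong {n} (λ _ → ℤₚ.+-inverseʳ c)) (spars-0 n)) ⟩
  spars {n} (λ _ → c ℤ.+ c) + 0 ≡⟨ ℕₚ.+-identityʳ _ ⟩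
  spars {n} (λ _ → c ℤ.+ c)     ≤⟨ spars-const n (c ℤ.+ c) ⟩
  1                             ∎
  where open ℕₚ.≤-Reasoning

2ℤ : ℤ
2ℤ = ℤ.+ 2

-- Twice a restriction is `g ⊞` plus or minus `g ⊟`, and scaling by a nonzero integer does not
-- change which coefficients vanish.
spars-restrict : ∀ {n} (g : Cube (suc n) → ℤ) b → spars (λ x → g (b ∷ x)) ≤ spars g
spars-restrict g false = begin
  spars (λ x → g (false ∷ x))                   ≡⟨ spars-* 2ℤ (λ x → g (false ∷ x)) (λ ()) ⟨
  spars (λ x → 2ℤ ℤ.* g (false ∷ x))            ≡⟨ spars-cong (λ x → double (g (false ∷ x)) (g (true ∷ x))) ⟩
  spars (λ x → (g ⊞) x ℤ.+ (g ⊟) x)             ≤⟨ spars-+ (g ⊞) (g ⊟) ⟩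
  spars g                                       ∎
  where
  open ℕₚ.≤-Reasoning
  double : ∀ a b → ℤ.+ 2 ℤ.* a ≡ a ℤ.+ b ℤ.+ (a ℤ.- b)
  double = solve-∀
spars-restrict g true = begin
  spars (λ x → g (true ∷ x))                    ≡⟨ spars-* 2ℤ (λ x → g (true ∷ x)) (λ ()) ⟨
  spars (λ x → 2ℤ ℤ.* g (true ∷ x))             ≡⟨ spars-cong (λ x → double (g (false ∷ x)) (g (true ∷ x))) ⟩
  spars (λ x → (g ⊞) x ℤ.+ -1ℤ ℤ.* (g ⊟) x)     ≤⟨ spars-+ (g ⊞) _ ⟩
  spars (g ⊞) + spars (λ x → -1ℤ ℤ.* (g ⊟) x)   ≡⟨ cong (spars (g ⊞) +_) (spars-* -1ℤ (g ⊟) (λ ())) ⟩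
  spars g                                       ∎
  where
  open ℕₚ.≤-Reasoning
  double : ∀ a b → ℤ.+ 2 ℤ.* b ≡ a ℤ.+ b ℤ.+ -1ℤ ℤ.* (a ℤ.- b)
  double = solve-∀

-- A subcube fixes the coordinates marked `just` and leaves the others free.
Subcube : ℕ → Set
Subcube n = Vec (Maybe Bool) n

dim : ∀ {n} → Subcube n → ℕ
dim []            = 0
dim (nothing ∷ ρ) = suc (dim ρ)
dim (just _ ∷ ρ)  = dim ρ

-- An iterated 𝔽₂-derivative of f in the free directions, evaluated at the fixed bits.
parity : ∀ {n} → BoolFun n → Subcube n → Bool
parity f []            = f []
parity f (nothing ∷ ρ) = parity (λ x → f (false ∷ x)) ρ xor parity (λ x → f (true ∷ x)) ρ
parity f (just b ∷ ρ)  = parity (λ x → f (b ∷ x)) ρ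

parity-cong : ∀ {n} {f g : BoolFun n} → f ≗ g → ∀ ρ → parity f ρ ≡ parity g ρ
parity-cong f≗g []            = f≗g []
parity-cong f≗g (nothing ∷ ρ) = cong₂ _xor_ (parity-cong (f≗g ∘ (false ∷_)) ρ) (parity-cong (f≗g ∘ (true ∷_)) ρ)
parity-cong f≗g (just b ∷ ρ)  = parity-cong (f≗g ∘ (b ∷_)) ρ

parity-xor : ∀ {n} (f g : BoolFun n) ρ → parity (λ x → f x xor g x) ρ ≡ parity f ρ xor parity g ρ
parity-xor f g []            = refl
parity-xor f g (nothing ∷ ρ) = trans
  (cong₂ _xor_ (parity-xor (f ∘ (false ∷_)) (g ∘ (false ∷_)) ρ) (parity-xor (f ∘ (true ∷_)) (g ∘ (true ∷_)) ρ))
  (xor-interchange (parity (f ∘ (false ∷_)) ρ) (parity (g ∘ (false ∷_)) ρ) _ _)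
parity-xor f g (just b ∷ ρ)  = parity-xor (f ∘ (b ∷_)) (g ∘ (b ∷_)) ρ

bit : Bool → ℤ
bit false = 0ℤ
bit true  = 1ℤ

-- The quotient k is part of the data, so that closure under sums and negation reduces to ring
-- identities.
_≡₂_ : ℤ → Bool → Set
a ≡₂ b = ∃ λ k → a ≡ bit b ℤ.+ 2ℤ ℤ.* k

≡₂-+ : ∀ {a b} c d → a ≡₂ c → b ≡₂ d → (a ℤ.+ b) ≡₂ (c xor d)
≡₂-+ false false (k , refl) (l , refl) = k ℤ.+ l , identity k l
  where
  identity : ∀ k l → 0ℤ ℤ.+ ℤ.+ 2 ℤ.* k ℤ.+ (0ℤ ℤ.+ ℤ.+ 2 ℤ.* l) ≡ 0ℤ ℤ.+ ℤ.+ 2 ℤ.* (k ℤ.+ l)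
  identity = solve-∀
≡₂-+ false true (k , refl) (l , refl) = k ℤ.+ l , identity k l
  where
  identity : ∀ k l → 0ℤ ℤ.+ ℤ.+ 2 ℤ.* k ℤ.+ (1ℤ ℤ.+ ℤ.+ 2 ℤ.* l) ≡ 1ℤ ℤ.+ ℤ.+ 2 ℤ.* (k ℤ.+ l)
  identity = solve-∀
≡₂-+ true false (k , refl) (l , refl) = k ℤ.+ l , identity k l
  where
  identity : ∀ k l → 1ℤ ℤ.+ ℤ.+ 2 ℤ.* k ℤ.+ (0ℤ ℤ.+ ℤ.+ 2 ℤ.* l) ≡ 1ℤ ℤ.+ ℤ.+ 2 ℤ.* (k ℤ.+ l)
  identity = solve-∀
≡₂-+ true true (k , refl) (l , refl) = 1ℤ ℤ.+ (k ℤ.+ l) , identity k l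
  where
  identity : ∀ k l → 1ℤ ℤ.+ ℤ.+ 2 ℤ.* k ℤ.+ (1ℤ ℤ.+ ℤ.+ 2 ℤ.* l) ≡ 0ℤ ℤ.+ ℤ.+ 2 ℤ.* (1ℤ ℤ.+ (k ℤ.+ l))
  identity = solve-∀

≡₂-neg : ∀ {a} c → a ≡₂ c → (ℤ.- a) ≡₂ c
≡₂-neg false (k , refl) = ℤ.- k , identity k
  where
  identity : ∀ k → ℤ.- (0ℤ ℤ.+ ℤ.+ 2 ℤ.* k) ≡ 0ℤ ℤ.+ ℤ.+ 2 ℤ.* (ℤ.- k)
  identity = solve-∀
≡₂-neg true (k , refl) = -1ℤ ℤ.- k , identity k
  where
  identity : ∀ k → ℤ.- (1ℤ ℤ.+ ℤ.+ 2 ℤ.* k) ≡ 1ℤ ℤ.+ ℤ.+ 2 ℤ.* (-1ℤ ℤ.- k)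
  identity = solve-∀

odd≢0 : ∀ k → 1ℤ ℤ.+ 2ℤ ℤ.* k ≢ 0ℤ
odd≢0 (ℤ.+ zero)  ()
odd≢0 (ℤ.+ suc m) ()
-- The rewrite exposes a second successor, after which the sum computes to a negative number.
odd≢0 -[1+ m ] eq rewrite ℕₚ.+-suc m (m + 0) with () ← eq

nonzero-odd : ∀ {a} → a ≡₂ true → 1 ≤ nonzero a
nonzero-odd (k , refl) with 1ℤ ℤ.+ 2ℤ ℤ.* k ℤ.≟ 0ℤ
... | yes eq = contradiction eq (odd≢0 k)
... | no _   = s≤s z≤n

-- If g sums to an odd number over a subcube in which the first coordinate is free, then so do
-- both g ⊞ and g ⊟ over its projection; their spectra partition that of g.
odd-spars : ∀ {n} (g : Cube n → ℤ) (f : BoolFun n) → (∀ x → g x ≡₂ f x) →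
  ∀ ρ → parity f ρ ≡ true → 2 ^ dim ρ ≤ spars g
odd-spars g f g≡f []            odd = nonzero-odd (subst (g [] ≡₂_) odd (g≡f []))
odd-spars g f g≡f (just b ∷ ρ)  odd =
  ℕₚ.≤-trans (odd-spars (g ∘ (b ∷_)) (f ∘ (b ∷_)) (g≡f ∘ (b ∷_)) ρ odd) (spars-restrict g b)
odd-spars g f g≡f (nothing ∷ ρ) odd = ℕₚ.+-mono-≤
  (odd-spars (g ⊞) f′ (λ x → ≡₂-+ (f (false ∷ x)) (f (true ∷ x)) (g≡f (false ∷ x)) (g≡f (true ∷ x))) ρ odd′)
  (ℕₚ.≤-trans (ℕₚ.≤-reflexive (ℕₚ.+-identityʳ _))
    (odd-spars (g ⊟) f′
      (λ x → ≡₂-+ (f (false ∷ x)) (f (true ∷ x)) (g≡f (false ∷ x)) (≡₂-neg (f (true ∷ x)) (g≡f (true ∷ x))))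
      ρ odd′))
  where
  f′ = λ x → f (false ∷ x) xor f (true ∷ x)
  odd′ = trans (parity-xor (f ∘ (false ∷_)) (f ∘ (true ∷_)) ρ) odd

-- `sign ∘ f` is odd everywhere and carries no information mod 2, so `odd-spars` is applied to the
-- 0/1 function `bit ∘ f`. As -2 times a bit is its sign minus 1, the two supports differ at most in
-- the trivial character; hence the `+ 1`.
odd-subcube : ∀ {n} (f : BoolFun n) ρ → parity f ρ ≡ true → 2 ^ dim ρ ≤ sparsity f + 1
odd-subcube {n} f ρ odd = begin
  2 ^ dim ρ                                  ≤⟨ odd-spars (bit ∘ f) f (λ x → 0ℤ , sym (ℤₚ.+-identityʳ (bit (f x)))) ρ odd ⟩
  spars (bit ∘ f)                            ≡⟨ spars-* -2ℤ (bit ∘ f) (λ ()) ⟨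
  spars (λ x → -2ℤ ℤ.* bit (f x))            ≡⟨ spars-cong (λ x → -2bit (f x)) ⟩
  spars (λ x → sign (f x) ℤ.+ -1ℤ)           ≤⟨ spars-+ (sign ∘ f) (λ _ → -1ℤ) ⟩
  spars (sign ∘ f) + spars {n} (λ _ → -1ℤ)   ≤⟨ ℕₚ.+-monoʳ-≤ _ (spars-const n -1ℤ) ⟩
  spars (sign ∘ f) + 1                       ≡⟨ cong (_+ 1) (sparsity-spars f) ⟨
  sparsity f + 1                             ∎
  where
  open ℕₚ.≤-Reasoning
  -2ℤ = -[1+ 1 ]
  -2bit : ∀ b → -2ℤ ℤ.* bit b ≡ sign b ℤ.+ -1ℤ
  -2bit false = refl
  -2bit true  = refl

-- Fourier inversion: up to scaling, `g u` is the sum of `hat g S` times the character S at u, so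
-- only characters in the support can tell u from v. The bits a and b accumulate the parities of the
-- coordinates already stripped off, which makes the induction go through.
hat-separates : ∀ {n} (g : Cube n → ℤ) (u v : Cube n) (a b : Bool) →
  (∀ S → hat g S ≢ 0ℤ → a xor dotParity S u ≡ b xor dotParity S v) →
  sign a ℤ.* g u ≡ sign b ℤ.* g v
hat-separates g [] [] a b agree with g [] ℤ.≟ 0ℤ
... | yes eq rewrite eq = trans (ℤₚ.*-zeroʳ (sign a)) (sym (ℤₚ.*-zeroʳ (sign b)))
... | no neq = cong (λ c → sign c ℤ.* g []) (begin
  a           ≡⟨ xor-identityʳ a ⟨
  a xor false ≡⟨ agree [] neq ⟩
  b xor false ≡⟨ xor-identityʳ b ⟩
  b           ∎)
  where open ≡-Reasoning
-- Inverting one coordinate recovers twice the value from `g ⊞` and `g ⊟`, so a factor 2 is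
-- introduced and cancelled.
hat-separates g (c ∷ u) (d ∷ v) a b agree = ℤₚ.*-cancelˡ-≡ 2ℤ _ _ (begin
  2ℤ ℤ.* (sign a ℤ.* g (c ∷ u))                          ≡⟨ split a c u ⟩
  sign a ℤ.* (g ⊞) u ℤ.+ sign (a xor c) ℤ.* (g ⊟) u      ≡⟨ cong₂ ℤ._+_
      (hat-separates (g ⊞) u v a b (λ S → agree (false ∷ S)))
      (hat-separates (g ⊟) u v (a xor c) (b xor d) (λ S nz →
        trans (xor-assoc a c _) (trans (agree (true ∷ S) nz) (sym (xor-assoc b d _))))) ⟩
  sign b ℤ.* (g ⊞) v ℤ.+ sign (b xor d) ℤ.* (g ⊟) v      ≡⟨ split b d v ⟨
  2ℤ ℤ.* (sign b ℤ.* g (d ∷ v))                          ∎)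
  where
  open ≡-Reasoning
  even : ∀ s x y → ℤ.+ 2 ℤ.* (s ℤ.* x) ≡ s ℤ.* (x ℤ.+ y) ℤ.+ s ℤ.* (x ℤ.- y)
  even = solve-∀
  odd : ∀ s x y → ℤ.+ 2 ℤ.* (s ℤ.* y) ≡ s ℤ.* (x ℤ.+ y) ℤ.+ (ℤ.- s) ℤ.* (x ℤ.- y)
  odd = solve-∀
  split : ∀ a c x → 2ℤ ℤ.* (sign a ℤ.* g (c ∷ x)) ≡ sign a ℤ.* (g ⊞) x ℤ.+ sign (a xor c) ℤ.* (g ⊟) x
  split a false x rewrite xor-comm a false = even (sign a) (g (false ∷ x)) (g (true ∷ x))
  split a true  x rewrite xor-comm a true | sign-not a = odd (sign a) (g (false ∷ x)) (g (true ∷ x))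

-- Linear algebra modulo the kernel of the characters

zeros ones : ∀ {n} → Cube n
zeros = replicate _ false
ones  = replicate _ true

unit : ∀ {n} → Fin n → Cube n
unit i = zeros [ i ]≔ true

weight : ∀ {n} → Cube n → ℕ
weight []          = 0
weight (true ∷ x)  = suc (weight x)
weight (false ∷ x) = weight x

_⊕_ : ∀ {n} → Cube n → Cube n → Cube n
_⊕_ = xorVec

_∖_ : ∀ {n} → Cube n → Cube n → Cube n
_∖_ = zipWith (λ a b → a ∧ not b)

_⊑_ : ∀ {n} → Cube n → Cube n → Set
_⊑_ = Pointwise Bool._≤_

⊑-refl : ∀ {n} {x : Cube n} → x ⊑ x
⊑-refl = Pointwise.refl b≤b

⊑-trans : ∀ {n} {x y z : Cube n} → x ⊑ y → y ⊑ z → x ⊑ z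
⊑-trans = Pointwise.trans Boolₚ.≤-trans

zeros-⊑ : ∀ {n} (x : Cube n) → zeros ⊑ x
zeros-⊑ []      = []
zeros-⊑ (a ∷ x) = Boolₚ.≤-minimum a ∷ zeros-⊑ x

⊑-ones : ∀ {n} (x : Cube n) → x ⊑ ones
⊑-ones []      = []
⊑-ones (a ∷ x) = Boolₚ.≤-maximum a ∷ ⊑-ones x

⊑-update : ∀ {n} (x : Cube n) i → x ⊑ (x [ i ]≔ true)
⊑-update (a ∷ x) zero    = Boolₚ.≤-maximum a ∷ ⊑-refl
⊑-update (a ∷ x) (suc i) = b≤b ∷ ⊑-update x i

update-⊑ : ∀ {n} {x y : Cube n} i → x ⊑ y → lookup y i ≡ true → (x [ i ]≔ true) ⊑ y
update-⊑ zero    (_ ∷ x⊑y)   refl = b≤b ∷ x⊑y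
update-⊑ (suc i) (a≤b ∷ x⊑y) eq   = a≤b ∷ update-⊑ i x⊑y eq

unit-⊑ : ∀ {n} (x : Cube n) i → lookup x i ≡ true → unit i ⊑ x
unit-⊑ x i = update-⊑ i (zeros-⊑ x)

⊕-⊑ : ∀ {n} {x y z : Cube n} → x ⊑ z → y ⊑ z → (x ⊕ y) ⊑ z
⊕-⊑ []        []        = []
⊕-⊑ {x = a ∷ _} {b ∷ _} (a≤c ∷ x⊑z) (b≤c ∷ y⊑z) = bound a b a≤c b≤c ∷ ⊕-⊑ x⊑z y⊑z
  where
  bound : ∀ a b {c} → a Bool.≤ c → b Bool.≤ c → (a xor b) Bool.≤ c
  bound true  true  _ _ = Boolₚ.≤-minimum _
  bound true  false p _ = p
  bound false b     _ q = q

weight-update : ∀ {n} (x : Cube n) i → weight (x [ i ]≔ true) ≤ suc (weight x)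
weight-update (true ∷ x)  zero    = ℕₚ.n≤1+n _
weight-update (false ∷ x) zero    = ℕₚ.≤-refl
weight-update (true ∷ x)  (suc i) = s≤s (weight-update x i)
weight-update (false ∷ x) (suc i) = weight-update x i

weight-∖ : ∀ {n} (x y : Cube n) → weight x ≤ weight y + weight (x ∖ y)
weight-∖ []          []          = z≤n
weight-∖ (true ∷ x)  (true ∷ y)  = s≤s (weight-∖ x y)
weight-∖ (true ∷ x)  (false ∷ y) rewrite ℕₚ.+-suc (weight y) (weight (x ∖ y)) = s≤s (weight-∖ x y)
weight-∖ (false ∷ x) (true ∷ y)  = ℕₚ.m≤n⇒m≤1+n (weight-∖ x y)
weight-∖ (false ∷ x) (false ∷ y) = weight-∖ x y

weight-zeros : ∀ n → weight (zeros {n}) ≡ 0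
weight-zeros zero    = refl
weight-zeros (suc n) = weight-zeros n

weight-ones : ∀ n → weight (ones {n}) ≡ n
weight-ones zero    = refl
weight-ones (suc n) = cong suc (weight-ones n)

positive-weight : ∀ {n} (x : Cube n) → 0 < weight x → ∃ λ i → lookup x i ≡ true
positive-weight (true ∷ x)  _ = zero , refl
positive-weight (false ∷ x) w with i , eq ← positive-weight x w = suc i , eq

⊕-identityˡ : ∀ {n} (x : Cube n) → zeros ⊕ x ≡ x
⊕-identityˡ = Vecₚ.zipWith-identityˡ (λ _ → refl)

⊕-cancelʳ : ∀ {n} (x y : Cube n) → (x ⊕ y) ⊕ y ≡ x
⊕-cancelʳ []      []      = refl
⊕-cancelʳ (a ∷ x) (b ∷ y) = cong₂ _∷_
  (trans (xor-assoc a b b) (trans (cong (a xor_) (xor-same b)) (xor-identityʳ a))) (⊕-cancelʳ x y)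

flipAt-⊕ : ∀ {n} (i : Fin n) x → flipAt i x ≡ x ⊕ unit i
flipAt-⊕ zero    (b ∷ x) = cong₂ _∷_ (xor-comm true b) (sym (Vecₚ.zipWith-identityʳ xor-identityʳ x))
flipAt-⊕ (suc i) (b ∷ x) = cong₂ _∷_ (sym (xor-identityʳ b)) (flipAt-⊕ i x)

dotParity-⊕ : ∀ {n} (S x y : Cube n) → dotParity S (x ⊕ y) ≡ dotParity S x xor dotParity S y
dotParity-⊕ []      []      []      = refl
dotParity-⊕ (s ∷ S) (a ∷ x) (b ∷ y) = trans
  (cong₂ _xor_ (∧-distribˡ-xor s a b) (dotParity-⊕ S x y))
  (xor-interchange (s ∧ a) (s ∧ b) _ _)

-- The unit vectors generate the cube under `⊕`.
⊕-induction : ∀ {n} (P : Cube n → Set) → P zeros → (∀ i x → P x → P (unit i ⊕ x)) → ∀ x → P x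
⊕-induction {zero}  P base step []      = base
⊕-induction {suc n} P base step (b ∷ x) = extend b
  where
  tail : P (false ∷ x)
  tail = ⊕-induction (P ∘ (false ∷_)) base (λ i y → step (suc i) (false ∷ y)) x
  extend : ∀ b → P (b ∷ x)
  extend false = tail
  extend true  = subst (λ y → P (true ∷ y)) (⊕-identityˡ x) (step zero (false ∷ x) tail)

-- Congruence modulo the common kernel of the characters in L.
Agree : ∀ {n} → List (Cube n) → Cube n → Cube n → Set
Agree L x y = All (λ S → dotParity S x ≡ dotParity S y) L

agree-⊕ : ∀ {n} {L : List (Cube n)} {x x′ y y′} → Agree L x x′ → Agree L y y′ → Agree L (x ⊕ y) (x′ ⊕ y′)
agree-⊕ {L = []}    []      []      = []
agree-⊕ {L = S ∷ L} {x} {x′} {y} {y′} (p ∷ ps) (q ∷ qs) =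
  trans (dotParity-⊕ S x y) (trans (cong₂ _xor_ p q) (sym (dotParity-⊕ S x′ y′))) ∷ agree-⊕ ps qs

agree-refl : ∀ {n} {L : List (Cube n)} x → Agree L x x
agree-refl x = All.universal (λ _ → refl) _

-- A small spanning set of coordinates inside X: modulo the kernel of L, each unit vector of X
-- equals a vector supported on `set`. Making `rep` total, with constraints only on X, keeps
-- membership proofs out of the vectors themselves.
record Basis {n} (L : List (Cube n)) (X : Cube n) : Set where
  field
    set       : Cube n
    set-⊑     : set ⊑ X
    small     : weight set ≤ length L
    rep       : Fin n → Cube n
    rep-⊑     : ∀ i → lookup X i ≡ true → rep i ⊑ set
    rep-agree : ∀ i → lookup X i ≡ true → Agree L (rep i) (unit i)

xor-false : ∀ {a b} → a xor b ≡ false → a ≡ b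
xor-false {false} eq = sym eq
xor-false {true} {true} _ = refl

xor-flip : ∀ {a b c d} → a ≢ b → c ≢ d → a xor c ≡ b xor d
xor-flip {false} {false} {c}     {d}     a≢b c≢d = contradiction refl a≢b
xor-flip {true}  {true}  {c}     {d}     a≢b c≢d = contradiction refl a≢b
xor-flip {false} {true}  {false} {false} a≢b c≢d = contradiction refl c≢d
xor-flip {false} {true}  {true}  {true}  a≢b c≢d = contradiction refl c≢d
xor-flip {false} {true}  {false} {true}  a≢b c≢d = refl
xor-flip {false} {true}  {true}  {false} a≢b c≢d = refl
xor-flip {true}  {false} {false} {false} a≢b c≢d = contradiction refl c≢d
xor-flip {true}  {false} {true}  {true}  a≢b c≢d = contradiction refl c≢d
xor-flip {true}  {false} {false} {true}  a≢b c≢d = refl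
xor-flip {true}  {false} {true}  {false} a≢b c≢d = refl

-- A character S separating rep j from unit j makes w = rep j ⊕ unit j a vector that earlier
-- characters ignore, so adding w repairs every other representative at the cost of one element.
basis : ∀ {n} (L : List (Cube n)) (X : Cube n) → Basis L X
basis {n} [] X = record
  { set = zeros; set-⊑ = zeros-⊑ X; small = ℕₚ.≤-reflexive (weight-zeros n)
  ; rep = λ _ → zeros; rep-⊑ = λ _ _ → ⊑-refl; rep-agree = λ _ _ → [] }
basis {n} (S ∷ L) X = extend (Finₚ.any? λ i →
  (lookup X i Bool.≟ true) ×-dec ¬? (dotParity S (rep i) Bool.≟ dotParity S (unit i)))
  where
  open Basis (basis L X)
  Separated : Fin n → Set
  Separated i = lookup X i ≡ true × dotParity S (rep i) ≢ dotParity S (unit i)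
  extend : Dec (∃ Separated) → Basis (S ∷ L) X
  extend (no none) = record
    { set = set; set-⊑ = set-⊑; small = ℕₚ.m≤n⇒m≤1+n small; rep = rep; rep-⊑ = rep-⊑
    ; rep-agree = λ i i∈X →
        decidable-stable (_ Bool.≟ _) (λ neq → none (i , i∈X , neq)) ∷ rep-agree i i∈X }
  extend (yes (j , j∈X , sep)) = record
    { set = set [ j ]≔ true
    ; set-⊑ = update-⊑ j set-⊑ j∈X
    ; small = ℕₚ.≤-trans (weight-update set j) (s≤s small)
    ; rep = rep′; rep-⊑ = rep′-⊑; rep-agree = rep′-agree }
    where
    w : Cube n
    w = rep j ⊕ unit j
    w-⊑ : w ⊑ (set [ j ]≔ true)
    w-⊑ = ⊕-⊑ (⊑-trans (rep-⊑ j j∈X) (⊑-update set j)) (unit-⊑ _ j (Vecₚ.lookup∘updateAt j set))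
    dot-w : dotParity S w ≢ false
    dot-w eq = sep (xor-false (trans (sym (dotParity-⊕ S (rep j) (unit j))) eq))
    w-agree : Agree L w zeros
    w-agree = subst (Agree L w) (⊕-cancel (unit j)) (agree-⊕ (rep-agree j j∈X) (agree-refl (unit j)))
      where
      ⊕-cancel : ∀ x → x ⊕ x ≡ zeros
      ⊕-cancel x = trans (cong (_⊕ x) (sym (⊕-identityˡ x))) (⊕-cancelʳ zeros x)
    rep′ : Fin n → Cube n
    rep′ i with dotParity S (rep i) Bool.≟ dotParity S (unit i)
    ... | yes _ = rep i
    ... | no  _ = rep i ⊕ w
    rep′-⊑ : ∀ i → lookup X i ≡ true → rep′ i ⊑ (set [ j ]≔ true)
    rep′-⊑ i i∈X with dotParity S (rep i) Bool.≟ dotParity S (unit i)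
    ... | yes _ = ⊑-trans (rep-⊑ i i∈X) (⊑-update set j)
    ... | no  _ = ⊕-⊑ (⊑-trans (rep-⊑ i i∈X) (⊑-update set j)) w-⊑
    rep′-agree : ∀ i → lookup X i ≡ true → Agree (S ∷ L) (rep′ i) (unit i)
    rep′-agree i i∈X with dotParity S (rep i) Bool.≟ dotParity S (unit i)
    ... | yes eq = eq ∷ rep-agree i i∈X
    ... | no neq =
      trans (dotParity-⊕ S (rep i) w) (trans (xor-flip neq dot-w) (xor-identityʳ _)) ∷
      subst (Agree L (rep i ⊕ w)) (Vecₚ.zipWith-identityʳ xor-identityʳ (unit i))
        (agree-⊕ (rep-agree i i∈X) w-agree)

-- Sum the representatives of the unit vectors that make up x; sums of vectors below `set` stay
-- below it.
basis-spans : ∀ {n} {L : List (Cube n)} (B : Basis L ones) x → ∃ λ p → p ⊑ Basis.set B × Agree L p x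
basis-spans {n} {L} B = ⊕-induction _ (zeros , zeros-⊑ _ , agree-refl zeros) λ i x (p , p⊑ , p~x) →
  rep i ⊕ p , ⊕-⊑ (rep-⊑ i (Vecₚ.lookup-replicate i true)) p⊑ ,
  agree-⊕ (rep-agree i (Vecₚ.lookup-replicate i true)) p~x
  where open Basis B

∈-allCube : ∀ {n} (x : Cube n) → x ∈ allCube n
∈-allCube []          = here refl
∈-allCube (false ∷ x) = ∈-++⁺ˡ (∈-map⁺ (false ∷_) (∈-allCube x))
∈-allCube {suc n} (true ∷ x) = ∈-++⁺ʳ (List.map (false ∷_) (allCube n)) (∈-map⁺ (true ∷_) (∈-allCube x))

support : ∀ {n} → BoolFun n → List (Cube n)
support {n} f = filter (λ S → ¬? (fourierNum f S ℤ.≟ 0ℤ)) (allCube n)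

-- By `hat-separates`, f factors through the quotient by the kernel of its spectrum. Every later
-- exchange of a vector for its representative rests on this.
agree-support : ∀ {n} (f : BoolFun n) {x y} → Agree (support f) x y → f x ≡ f y
agree-support f {x} {y} agree = sign-injective (f x) (f y) (begin
  sign (f x)           ≡⟨ ℤₚ.*-identityˡ _ ⟨
  1ℤ ℤ.* sign (f x)    ≡⟨ hat-separates (sign ∘ f) x y false false equal ⟩
  1ℤ ℤ.* sign (f y)    ≡⟨ ℤₚ.*-identityˡ _ ⟩
  sign (f y)           ∎)
  where
  open ≡-Reasoning
  equal : ∀ S → hat (sign ∘ f) S ≢ 0ℤ → dotParity S x ≡ dotParity S y
  equal S nz = All.lookup agree (∈-filter⁺ (λ S → ¬? (fourierNum f S ℤ.≟ 0ℤ)) (∈-allCube S)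
    (λ eq → nz (trans (sym (fourierNum-hat f S)) eq)))
  sign-injective : ∀ a b → sign a ≡ sign b → a ≡ b
  sign-injective false false _ = refl
  sign-injective true  true  _ = refl

-- The value f x itself need not be b; this is what allows the start to be lowered freely.
data Climb {n} (f : BoolFun n) : Bool → Cube n → ℕ → Set where
  done : ∀ {b x} → Climb f b x 0
  step : ∀ {b x y k} → x ⊑ y → f y ≡ not b → Climb f (not b) y k → Climb f b x (suc k)

climb-⊑ : ∀ {n} {f : BoolFun n} {b x y k} → x ⊑ y → Climb f b y k → Climb f b x k
climb-⊑ x⊑y done               = done
climb-⊑ x⊑y (step y⊑z eq rest) = step (⊑-trans x⊑y y⊑z) eq rest

-- Alternation measured on climbs with arbitrarily long jumps. Unlike maximal chains, these can be
-- shortened, lowered and transported along monotone maps.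
AltBound : ∀ {n} → BoolFun n → ℕ → Set
AltBound f K = ∀ {k} → Climb f (f zeros) zeros k → k ≤ K

≢⇒≡not : ∀ {a b} → a ≢ b → b ≡ not a
≢⇒≡not {false} {false} a≢b = contradiction refl a≢b
≢⇒≡not {false} {true}  a≢b = refl
≢⇒≡not {true}  {false} a≢b = refl
≢⇒≡not {true}  {true}  a≢b = contradiction refl a≢b

-- Lower the start to 0. If f has the other value there, the jump from 0 to x is one extra
-- alternation, which only strengthens the bound.
altBound-climb : ∀ {n} {f : BoolFun n} {K k} x → AltBound f K → Climb f (f x) x k → k ≤ K
altBound-climb {f = f} x bound climb with f zeros Bool.≟ f x
... | yes eq = bound (climb-⊑ (zeros-⊑ x) (subst (λ b → Climb f b x _) (sym eq) climb))
... | no neq = ℕₚ.≤-trans (ℕₚ.n≤1+n _)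
  (bound (step (zeros-⊑ x) (≢⇒≡not neq) (subst (λ b → Climb f b x _) (≢⇒≡not neq) climb)))

-- Disjoint bases and the bound on the number of variables

Disjoint : ∀ {n} → Cube n → Cube n → Set
Disjoint = Pointwise (λ a b → a ∧ b ≡ false)

disjoint-zeros : ∀ {n} (x : Cube n) → Disjoint zeros x
disjoint-zeros []      = []
disjoint-zeros (_ ∷ x) = refl ∷ disjoint-zeros x

disjoint-⊑ : ∀ {n} {q t X : Cube n} → Disjoint q X → t ⊑ X → q ⊑ (q ⊕ t)
disjoint-⊑ []        []        = []
disjoint-⊑ {q = a ∷ _} {b ∷ _} (a⊥c ∷ q⊥X) (b≤c ∷ t⊑X) = bound a b a⊥c b≤c ∷ disjoint-⊑ q⊥X t⊑X
  where
  bound : ∀ a b {c} → a ∧ c ≡ false → b Bool.≤ c → a Bool.≤ (a xor b)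
  bound false b     _    _   = Boolₚ.≤-minimum b
  bound true  false _    _   = b≤b
  bound true  true  refl ()

disjoint-∖ : ∀ {n} {q t B X : Cube n} → Disjoint q X → t ⊑ B → Disjoint (q ⊕ t) (X ∖ B)
disjoint-∖ []        []        = []
disjoint-∖ {q = a ∷ _} {b ∷ _} {X = c ∷ _} (a⊥c ∷ q⊥X) (b≤d ∷ t⊑B) =
  bound a b c a⊥c b≤d ∷ disjoint-∖ q⊥X t⊑B
  where
  bound : ∀ a b c {d} → a ∧ c ≡ false → b Bool.≤ d → (a xor b) ∧ (c ∧ not d) ≡ false
  bound a     b     false     _ _   = Boolₚ.∧-zeroʳ (a xor b)
  bound false false true      _ _   = refl
  bound false true  true      _ b≤b = refl
  bound true  b     true      () _

∖-member : ∀ {n} (X B : Cube n) i → lookup (X ∖ B) i ≡ true → lookup X i ≡ true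
∖-member X B i eq rewrite Vecₚ.lookup-zipWith (λ a b → a ∧ not b) i X B with lookup X i
... | true = refl

-- Each basis removed costs at most `length L` coordinates, so the room for m more remains.
weight-rest : ∀ {n} {L : List (Cube n)} {m} (X : Cube n) (B : Basis L X) →
  suc m * length L < weight X → m * length L < weight (X ∖ Basis.set B)
weight-rest {L = L} {m} X B large = ℕₚ.+-cancelˡ-< (length L) _ _ (begin-strict
  length L + m * length L                       <⟨ large ⟩
  weight X                                      ≤⟨ weight-∖ X set ⟩
  weight set + weight (X ∖ set)                 ≤⟨ ℕₚ.+-monoˡ-≤ _ small ⟩
  length L + weight (X ∖ set)                   ∎)
  where
  open ℕₚ.≤-Reasoning
  open Basis B

module _ {n} (f : BoolFun n) where

  private
    L : List (Cube n)
    L = support f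

  shift : ∀ {x y} z → Agree L x y → f (z ⊕ x) ≡ f (z ⊕ y)
  shift z x~y = agree-support f (agree-⊕ (agree-refl z) x~y)

  -- Peel off m disjoint bases; a coordinate i left over is represented inside each of them, and
  -- adding these representatives one after the other toggles x_i up to the kernel of f.
  layered-climb : ∀ m (X : Cube n) → m * length L < weight X → ∃ λ i → lookup X i ≡ true ×
    (∀ q → Disjoint q X → f q ≢ f (q ⊕ unit i) → Climb f (f q) q m)
  layered-climb zero X large with i , i∈X ← positive-weight X large = i , i∈X , λ _ _ _ → done
  layered-climb (suc m) X large = i , i∈X , climb
    where
    B = basis L X
    open Basis B
    rest = layered-climb m (X ∖ set) (weight-rest {m = m} X B large)
    i = proj₁ rest
    i∈X = ∖-member X set i (proj₁ (proj₂ rest))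
    climb : ∀ q → Disjoint q X → f q ≢ f (q ⊕ unit i) → Climb f (f q) q (suc m)
    climb q q⊥X sensitive = step
      (disjoint-⊑ q⊥X (⊑-trans (rep-⊑ i i∈X) set-⊑))
      fq′
      (subst (λ b → Climb f b q′ m) fq′
        (proj₂ (proj₂ rest) q′ (disjoint-∖ q⊥X (rep-⊑ i i∈X)) sensitive′))
      where
      q′ = q ⊕ rep i
      fq′≡ : f q′ ≡ f (q ⊕ unit i)
      fq′≡ = shift q (rep-agree i i∈X)
      fq′ : f q′ ≡ not (f q)
      fq′ = ≢⇒≡not (λ eq → sensitive (trans eq fq′≡))
      -- Modulo the kernel `rep i` is `unit i`, so adding `unit i` to `q′` undoes the toggle. Thus
      -- `q′` is again sensitive at i, and the next layer can start from it.
      back : f (q′ ⊕ unit i) ≡ f q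
      back = trans (agree-support f (agree-⊕ (agree-⊕ (agree-refl q) (rep-agree i i∈X)) (agree-refl (unit i))))
        (cong f (⊕-cancelʳ q (unit i)))
      sensitive′ : f q′ ≢ f (q′ ⊕ unit i)
      sensitive′ eq = sensitive (trans (sym back) (trans (sym eq) fq′≡))

  dependent-bound : ∀ {K} → DependsOnAll f → AltBound f K → n ≤ (2 + K) * sparsity f
  dependent-bound {K} dep bound = ℕₚ.≮⇒≥ λ large →
    let open Basis B
        -- One basis is set aside to reach a sensitive point; the other K + 1 give a climb one step
        -- longer than K allows.
        i , _ , climb = layered-climb (suc K) (ones ∖ set)
          (weight-rest {m = suc K} ones B (subst ((2 + K) * sparsity f <_) (sym (weight-ones n)) large))
        x , sensitive = dep i
        -- The sensitive point x may meet the other layers, so it is replaced by an equivalent p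
        -- inside the basis set aside.
        p , p⊑ , p~x = basis-spans B x
        p-sensitive : f p ≢ f (p ⊕ unit i)
        p-sensitive eq = sensitive (begin
          f x              ≡⟨ agree-support f p~x ⟨
          f p              ≡⟨ eq ⟩
          f (p ⊕ unit i)   ≡⟨ agree-support f (agree-⊕ p~x (agree-refl (unit i))) ⟩
          f (x ⊕ unit i)   ≡⟨ cong f (flipAt-⊕ i x) ⟨
          f (flipAt i x)   ∎)
        p⊥ : Disjoint p (ones ∖ set)
        p⊥ = subst (λ z → Disjoint z (ones ∖ set)) (⊕-identityˡ p)
          (disjoint-∖ (disjoint-zeros ones) p⊑)
    in ℕₚ.<-irrefl refl (altBound-climb p bound (climb p p⊥ p-sensitive))
    where
    open ≡-Reasoning
    B = basis L ones

-- Degree and decision trees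

-- Over 𝔽₂ the polynomial of f has degree < d iff f has even sum over every subcube of dimension ≥ d.
Degree< : ∀ {n} → ℕ → BoolFun n → Set
Degree< d f = ∀ ρ → d ≤ dim ρ → parity f ρ ≡ false

parity-const : ∀ {n} c (ρ : Subcube n) → 0 < dim ρ → parity (λ _ → c) ρ ≡ false
parity-const c (nothing ∷ ρ) _ = xor-same (parity (λ _ → c) ρ)
parity-const c (just _ ∷ ρ)  p = parity-const c ρ p

-- The arity stays n and coordinate i becomes one that the function ignores, so no indices need
-- renaming along a decision tree.
restrict : ∀ {n} → BoolFun n → Fin n → Bool → BoolFun n
restrict f i b x = f (x [ i ]≔ b)

-- The restriction ignores coordinate i, so the two halves of the subcube in that direction cancel.
parity-restrict-free : ∀ {n} (f : BoolFun n) i b ρ → lookup ρ i ≡ nothing → parity (restrict f i b) ρ ≡ false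
parity-restrict-free f zero    b (nothing ∷ ρ) _  = xor-same (parity (f ∘ (b ∷_)) ρ)
parity-restrict-free f (suc i) b (just a ∷ ρ)  eq = parity-restrict-free (f ∘ (a ∷_)) i b ρ eq
parity-restrict-free f (suc i) b (nothing ∷ ρ) eq = cong₂ _xor_
  (parity-restrict-free (f ∘ (false ∷_)) i b ρ eq) (parity-restrict-free (f ∘ (true ∷_)) i b ρ eq)

parity-restrict-fixed : ∀ {n} (f : BoolFun n) i b ρ {c} → lookup ρ i ≡ just c →
  parity (restrict f i b) ρ ≡ parity f (ρ [ i ]≔ just b)
parity-restrict-fixed f zero    b (just _ ∷ ρ)  _  = refl
parity-restrict-fixed f (suc i) b (just a ∷ ρ)  eq = parity-restrict-fixed (f ∘ (a ∷_)) i b ρ eq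
parity-restrict-fixed f (suc i) b (nothing ∷ ρ) eq = cong₂ _xor_
  (parity-restrict-fixed (f ∘ (false ∷_)) i b ρ eq) (parity-restrict-fixed (f ∘ (true ∷_)) i b ρ eq)

parity-split : ∀ {n} (f : BoolFun n) i ρ →
  parity f (ρ [ i ]≔ nothing) ≡ parity f (ρ [ i ]≔ just false) xor parity f (ρ [ i ]≔ just true)
parity-split f zero    (_ ∷ ρ)       = refl
parity-split f (suc i) (just a ∷ ρ)  = parity-split (f ∘ (a ∷_)) i ρ
parity-split f (suc i) (nothing ∷ ρ) = trans
  (cong₂ _xor_ (parity-split (f ∘ (false ∷_)) i ρ) (parity-split (f ∘ (true ∷_)) i ρ))
  (xor-interchange (parity (f ∘ (false ∷_)) (ρ [ i ]≔ just false)) _ _ _)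

dim-fix : ∀ {n} i (ρ : Subcube n) {b c} → lookup ρ i ≡ just c → dim (ρ [ i ]≔ just b) ≡ dim ρ
dim-fix zero    (just _ ∷ ρ)  _  = refl
dim-fix (suc i) (just _ ∷ ρ)  eq = dim-fix i ρ eq
dim-fix (suc i) (nothing ∷ ρ) eq = cong suc (dim-fix i ρ eq)

dim-free : ∀ {n} i (ρ : Subcube n) {c} → lookup ρ i ≡ just c → dim (ρ [ i ]≔ nothing) ≡ suc (dim ρ)
dim-free zero    (just _ ∷ ρ)  _  = refl
dim-free (suc i) (just _ ∷ ρ)  eq = dim-free i ρ eq
dim-free (suc i) (nothing ∷ ρ) eq = cong suc (dim-free i ρ eq)

degree-restrict : ∀ {n d} {f : BoolFun n} i b → Degree< d f → Degree< d (restrict f i b)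
degree-restrict {f = f} i b deg ρ d≤ with lookup ρ i in eq
... | nothing = parity-restrict-free f i b ρ eq
... | just _  = trans (parity-restrict-fixed f i b ρ eq)
  (deg (ρ [ i ]≔ just b) (ℕₚ.≤-trans d≤ (ℕₚ.≤-reflexive (sym (dim-fix i ρ eq)))))

-- A derivative lowers the degree: its sum over a subcube with coordinate i fixed is the sum of f
-- over the subcube of one dimension more in which i is free.
degree-difference : ∀ {n d} {f : BoolFun n} i → Degree< (suc d) f →
  Degree< d (λ x → restrict f i false x xor restrict f i true x)
degree-difference {f = f} i deg ρ d≤ with lookup ρ i in eq
... | nothing = trans (parity-xor (restrict f i false) (restrict f i true) ρ)
  (cong₂ _xor_ (parity-restrict-free f i false ρ eq) (parity-restrict-free f i true ρ eq))
... | just _ = begin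
  parity (λ x → restrict f i false x xor restrict f i true x) ρ ≡⟨ parity-xor (restrict f i false) (restrict f i true) ρ ⟩
  parity (restrict f i false) ρ xor parity (restrict f i true) ρ
    ≡⟨ cong₂ _xor_ (parity-restrict-fixed f i false ρ eq) (parity-restrict-fixed f i true ρ eq) ⟩
  parity f (ρ [ i ]≔ just false) xor parity f (ρ [ i ]≔ just true) ≡⟨ parity-split f i ρ ⟨
  parity f (ρ [ i ]≔ nothing)
    ≡⟨ deg (ρ [ i ]≔ nothing) (ℕₚ.≤-trans (s≤s d≤) (ℕₚ.≤-reflexive (sym (dim-free i ρ eq)))) ⟩
  false                                                           ∎
  where open ≡-Reasoning

setAll : ∀ {n} → List (Fin n) → Cube n → Cube n
setAll T x = List.foldr (λ i y → y [ i ]≔ true) x T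

setAll-++ : ∀ {n} (S T : List (Fin n)) x → setAll (S ++ T) x ≡ setAll S (setAll T x)
setAll-++ S T x = Listₚ.foldr-++ _ x S T

degree-setAll : ∀ {n d} {f : BoolFun n} T → Degree< d f → Degree< d (f ∘ setAll T)
degree-setAll []      deg = deg
degree-setAll (i ∷ T) deg = degree-setAll T (degree-restrict i true deg)

update-mono : ∀ {n} {x y : Cube n} i b → x ⊑ y → (x [ i ]≔ b) ⊑ (y [ i ]≔ b)
update-mono zero    b (_ ∷ x⊑y) = b≤b ∷ x⊑y
update-mono (suc i) b (p ∷ x⊑y) = p ∷ update-mono i b x⊑y

setAll-mono : ∀ {n} {x y : Cube n} T → x ⊑ y → setAll T x ⊑ setAll T y
setAll-mono []      x⊑y = x⊑y
setAll-mono (i ∷ T) x⊑y = update-mono i true (setAll-mono T x⊑y)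

climb-∘ : ∀ {n} {f : BoolFun n} {b x k} (σ : Cube n → Cube n) → (∀ {x y} → x ⊑ y → σ x ⊑ σ y) →
  Climb (f ∘ σ) b x k → Climb f b (σ x) k
climb-∘ σ mono done               = done
climb-∘ σ mono (step x⊑y eq rest) = step (mono x⊑y) eq (climb-∘ σ mono rest)

-- Fixing a coordinate is a monotone map, so climbs of the restriction become climbs of f. They
-- start at the image of 0, which for b = true is not 0.
altBound-restrict : ∀ {n} {f : BoolFun n} {K} i b → AltBound f K → AltBound (restrict f i b) K
altBound-restrict i b bound climb =
  altBound-climb (zeros [ i ]≔ b) bound (climb-∘ (_[ i ]≔ b) (update-mono i b) climb)

-- Search the half with first bit false before the other: nothing in the upper half lies below a
-- point of the lower one, and the upper half is searched only when the lower one is empty.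
minimal : ∀ {n} (P : BoolFun n) →
  (∀ x → P x ≡ false) ⊎ (∃ λ y → P y ≡ true × (∀ z → z ⊑ y → P z ≡ true → z ≡ y))
minimal {zero} P with P [] in eq
... | false = inj₁ λ { [] → eq }
... | true  = inj₂ ([] , eq , λ { [] _ _ → refl })
minimal {suc n} P with minimal (P ∘ (false ∷_))
... | inj₂ (y , Py , min) = inj₂ (false ∷ y , Py , λ { (false ∷ z) (_ ∷ z⊑y) Pz → cong (false ∷_) (min z z⊑y Pz) })
... | inj₁ none₀ with minimal (P ∘ (true ∷_))
...   | inj₁ none₁ = inj₁ λ { (false ∷ x) → none₀ x ; (true ∷ x) → none₁ x }
...   | inj₂ (y , Py , min) = inj₂ (true ∷ y , Py , λ
  { (false ∷ z) _         Pz → contradiction (trans (sym Pz) (none₀ z)) λ ()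
  ; (true ∷ z)  (_ ∷ z⊑y) Pz → cong (true ∷_) (min z z⊑y Pz) })

-- The down-set of y as a subcube. The parity of f over it is the coefficient of the monomial y in
-- the 𝔽₂-polynomial of f (Möbius inversion).
below : ∀ {n} → Cube n → Subcube n
below = map (if_then nothing else just false)

dim-below : ∀ {n} (y : Cube n) → dim (below y) ≡ weight y
dim-below []          = refl
dim-below (true ∷ y)  = cong suc (dim-below y)
dim-below (false ∷ y) = dim-below y

parity-below-zero : ∀ {n} (P : BoolFun n) y → (∀ z → z ⊑ y → P z ≡ false) → parity P (below y) ≡ false
parity-below-zero P []          vanish = vanish [] []
parity-below-zero P (true ∷ y)  vanish = cong₂ _xor_
  (parity-below-zero (P ∘ (false ∷_)) y (λ z z⊑y → vanish (false ∷ z) (f≤t ∷ z⊑y)))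
  (parity-below-zero (P ∘ (true ∷_)) y (λ z z⊑y → vanish (true ∷ z) (b≤b ∷ z⊑y)))
parity-below-zero P (false ∷ y) vanish =
  parity-below-zero (P ∘ (false ∷_)) y (λ z z⊑y → vanish (false ∷ z) (b≤b ∷ z⊑y))

parity-below-minimal : ∀ {n} (P : BoolFun n) y → P y ≡ true → (∀ z → z ⊑ y → P z ≡ true → z ≡ y) →
  parity P (below y) ≡ true
parity-below-minimal P []          Py min = Py
parity-below-minimal P (false ∷ y) Py min = parity-below-minimal (P ∘ (false ∷_)) y Py
  (λ z z⊑y Pz → Vecₚ.∷-injectiveʳ (min (false ∷ z) (b≤b ∷ z⊑y) Pz))
parity-below-minimal P (true ∷ y)  Py min = cong₂ _xor_
  (parity-below-zero (P ∘ (false ∷_)) y vanish)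
  (parity-below-minimal (P ∘ (true ∷_)) y Py (λ z z⊑y Pz → Vecₚ.∷-injectiveʳ (min (true ∷ z) (b≤b ∷ z⊑y) Pz)))
  where
  vanish : ∀ z → z ⊑ y → P (false ∷ z) ≡ false
  vanish z z⊑y with P (false ∷ z) in eq
  ... | false = refl
  ... | true  with () ← min (false ∷ z) (f≤t ∷ z⊑y) eq

elements : ∀ {n} → Cube n → List (Fin n)
elements []          = []
elements (true ∷ x)  = zero ∷ List.map suc (elements x)
elements (false ∷ x) = List.map suc (elements x)

length-elements : ∀ {n} (x : Cube n) → length (elements x) ≡ weight x
length-elements []          = refl
length-elements (true ∷ x)  = cong suc (trans (Listₚ.length-map suc (elements x)) (length-elements x))
length-elements (false ∷ x) = trans (Listₚ.length-map suc (elements x)) (length-elements x)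

setAll-suc : ∀ {n} b (T : List (Fin n)) x → setAll (List.map suc T) (b ∷ x) ≡ b ∷ setAll T x
setAll-suc b []      x = refl
setAll-suc b (i ∷ T) x = cong (_[ suc i ]≔ true) (setAll-suc b T x)

setAll-elements : ∀ {n} (y : Cube n) → setAll (elements y) zeros ≡ y
setAll-elements []          = refl
setAll-elements (true ∷ y)  = trans (cong (_[ zero ]≔ true) (setAll-suc false (elements y) zeros))
  (cong (true ∷_) (setAll-elements y))
setAll-elements (false ∷ y) = trans (setAll-suc false (elements y) zeros) (cong (false ∷_) (setAll-elements y))

xor-true : ∀ {a b} → a xor b ≡ true → a ≡ not b
xor-true {false} {true}  _ = refl
xor-true {true}  {false} _ = refl

-- Below a minimal y the function `f xor f zeros` is nonzero at y alone, so its sum there is odd. If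
-- y had weight above d, that dimension would force even sums for f and for the constant alike.
minimal-weight : ∀ {n d} (f : BoolFun n) → Degree< (suc d) f →
  ∀ y → f y xor f zeros ≡ true → (∀ z → z ⊑ y → f z xor f zeros ≡ true → z ≡ y) → weight y ≤ d
minimal-weight {d = d} f deg y Py min = ℕₚ.≮⇒≥ λ d<w → contradiction (begin
  true                                      ≡⟨ parity-below-minimal P y Py min ⟨
  parity P (below y)                        ≡⟨ parity-xor f (λ _ → f zeros) (below y) ⟩
  parity f (below y) xor parity (λ _ → f zeros) (below y)
    ≡⟨ cong₂ _xor_ (deg (below y) (large d<w)) (parity-const (f zeros) (below y) (ℕₚ.≤-trans (s≤s z≤n) (large d<w))) ⟩
  false                                     ∎) λ ()
  where
  open ≡-Reasoning
  P = λ x → f x xor f zeros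
  large : suc d ≤ weight y → suc d ≤ dim (below y)
  large = subst (suc d ≤_) (sym (dim-below y))

-- Climb from 0 through minimal points where f changes: each jump sets at most d coordinates to
-- true, and each uses up one alternation.
certificate : ∀ {n} K {d} (f : BoolFun n) → Degree< (suc d) f → AltBound f K →
  ∃ λ T → length T ≤ K * d × (∀ x → f (setAll T x) ≡ f (setAll T zeros))
certificate K f deg bound with minimal (λ x → f x xor f zeros)
... | inj₁ none = [] , z≤n , λ x → xor-false (none x)
-- The single jump from 0 to y is already one alternation too many.
certificate zero f deg bound | inj₂ (y , Py , min)
  with () ← bound (step (zeros-⊑ y) (xor-true Py) done)
certificate (suc K) {d} f deg bound | inj₂ (y , Py , min) = extend
  (certificate K (f ∘ setAll (elements y)) (degree-setAll (elements y) deg) bound′)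
  where
  bound′ : AltBound (f ∘ setAll (elements y)) K
  bound′ {k} climb = ℕₚ.≤-pred (bound (step (zeros-⊑ y) (xor-true Py)
    (subst₂ (λ b z → Climb f b z k) (trans (cong f (setAll-elements y)) (xor-true Py)) (setAll-elements y)
      (climb-∘ (setAll (elements y)) (setAll-mono (elements y)) climb))))
  extend : _ → _
  extend (T , small , const) = elements y ++ T , small′ ,
    λ x → trans (cong f (setAll-++ (elements y) T x))
      (trans (const x) (cong f (sym (setAll-++ (elements y) T zeros))))
    where
    small′ : length (elements y ++ T) ≤ suc K * d
    small′ rewrite Listₚ.length-++ (elements y) {T} | length-elements y =
      ℕₚ.+-mono-≤ (minimal-weight f deg y Py min) small

-- Decision trees and the protocols they induce

data Tree (n : ℕ) : Set where
  leaf  : Bool → Tree n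
  query : Fin n → Tree n → Tree n → Tree n

eval : ∀ {n} → Tree n → BoolFun n
eval (leaf b)      x = b
eval (query i l r) x = if lookup x i then eval r x else eval l x

height : ∀ {n} → Tree n → ℕ
height (leaf _)      = 0
height (query _ l r) = suc (height l ⊔ height r)

Decides : ∀ {n} → BoolFun n → ℕ → Set
Decides {n} f h = Σ (Tree n) λ t → height t ≤ h × (∀ x → eval t x ≡ f x)

decides-query : ∀ {n} {f : BoolFun n} {h} i →
  Decides (restrict f i false) h → Decides (restrict f i true) h → Decides f (suc h)
decides-query {f = f} i (l , hl , el) (r , hr , er) = query i l r , s≤s (ℕₚ.⊔-lub hl hr) , correct
  where
  correct : ∀ x → (if lookup x i then eval r x else eval l x) ≡ f x
  correct x with lookup x i in eq
  ... | true  = trans (er x) (cong f (trans (cong (x [ i ]≔_) (sym eq)) (Vecₚ.[]≔-lookup x i)))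
  ... | false = trans (el x) (cong f (trans (cong (x [ i ]≔_) (sym eq)) (Vecₚ.[]≔-lookup x i)))

-- Changing one coordinate of T changes the restriction by a function of lower degree, so if one
-- assignment to T lowers the degree then all of them do.
decides-after : ∀ {n K d h} T (f : BoolFun n) → Degree< (suc d) f → Degree< d (f ∘ setAll T) → AltBound f K →
  ((g : BoolFun n) → Degree< d g → AltBound g K → Decides g h) → Decides f (length T + h)
decides-after []      f deg low bound continue = continue f low bound
decides-after {d = d} (i ∷ T) f deg low bound continue = decides-query i
  (decides-after T (restrict f i false) (degree-restrict i false deg) low₀ (altBound-restrict i false bound) continue)
  -- `low` applies unchanged because `setAll (i ∷ T)` sets i last: composing it with f is by
  -- definition `restrict f i true ∘ setAll T`.
  (decides-after T (restrict f i true) (degree-restrict i true deg) low (altBound-restrict i true bound) continue)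
  where
  low₀ : Degree< d (restrict f i false ∘ setAll T)
  low₀ ρ d≤ = trans
    (xor-false (trans (sym (parity-xor (restrict f i false ∘ setAll T) (restrict f i true ∘ setAll T) ρ))
      (degree-setAll T (degree-difference i deg) ρ d≤)))
    (low ρ d≤)

-- Induction on the degree. Restrictions inherit the alternation bound, so the same K serves in
-- every round.
decision : ∀ {n} d K (f : BoolFun n) → Degree< (suc d) f → AltBound f K → Decides f (d * (K * d))
decision zero K f deg bound with certificate K f deg bound
-- In degree 0 the certificate has length at most K * 0, so f is constant.
... | []    , _     , const = leaf (f zeros) , z≤n , λ x → sym (const x)
... | _ ∷ _ , small , _     = contradiction (ℕₚ.≤-trans small (ℕₚ.≤-reflexive (ℕₚ.*-zeroʳ K))) λ ()
decision (suc d) K f deg bound with T , small , const ← certificate K f deg bound =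
  let t , h , correct = decides-after T f deg low bound (decision d K)
  in t , ℕₚ.≤-trans h (ℕₚ.+-mono-≤ small (ℕₚ.*-monoʳ-≤ d (ℕₚ.*-monoʳ-≤ K (ℕₚ.n≤1+n d)))) , correct
  where
  low : Degree< (suc d) (f ∘ setAll T)
  low ρ d≤ = trans (parity-cong const ρ) (parity-const _ ρ (ℕₚ.≤-trans (s≤s z≤n) d≤))

-- To query a bit of the xor, both players announce their own bit; a true bit of Alice inverts the
-- answer, hence the swapped subtrees. Two bits are spent per query.
protocol : ∀ {n} → Tree n → Protocol n
protocol (leaf b)      = leaf b
protocol (query i l r) =
  alice (λ x → lookup x i) (bob (λ y → lookup y i) (protocol l) (protocol r))
                           (bob (λ y → lookup y i) (protocol r) (protocol l))

run-protocol : ∀ {n} (t : Tree n) x y → run (protocol t) x y ≡ eval t (xorVec x y)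
run-protocol (leaf b)      x y = refl
run-protocol (query i l r) x y rewrite Vecₚ.lookup-zipWith _xor_ i x y with lookup x i | lookup y i
... | false | false = run-protocol l x y
... | false | true  = run-protocol r x y
... | true  | false = run-protocol r x y
... | true  | true  = run-protocol l x y

depth-protocol : ∀ {n} (t : Tree n) → depth (protocol t) ≤ 2 * height t
depth-protocol (leaf b)      = z≤n
depth-protocol (query i l r) = begin
  suc (suc (dl ⊔ dr) ⊔ suc (dr ⊔ dl))   ≡⟨ cong (λ m → suc (suc (dl ⊔ dr) ⊔ suc m)) (ℕₚ.⊔-comm dr dl) ⟩
  suc (suc (dl ⊔ dr) ⊔ suc (dl ⊔ dr))   ≡⟨ cong suc (ℕₚ.⊔-idem _) ⟩
  2 + (dl ⊔ dr)                         ≤⟨ ℕₚ.+-monoʳ-≤ 2 (ℕₚ.⊔-mono-≤ (depth-protocol l) (depth-protocol r)) ⟩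
  2 + (2 * height l ⊔ 2 * height r)     ≡⟨ cong (2 +_) (ℕₚ.*-distribˡ-⊔ 2 (height l) (height r)) ⟨
  2 + 2 * (height l ⊔ height r)         ≡⟨ ℕₚ.*-suc 2 (height l ⊔ height r) ⟨
  2 * suc (height l ⊔ height r)         ∎
  where
  open ℕₚ.≤-Reasoning
  dl = depth (protocol l)
  dr = depth (protocol r)

decides-CC : ∀ {n} {f : BoolFun n} {h} → Decides f h → XorCCAtMost f (2 * h)
decides-CC (t , h , correct) = protocol t ,
  ℕₚ.≤-trans (depth-protocol t) (ℕₚ.*-monoʳ-≤ 2 h) ,
  λ x y → trans (run-protocol t x y) (correct (xorVec x y))

-- Chains

data Path {n} : Cube n → Cube n → ℕ → Set where
  []   : ∀ {x} → Path x x 0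
  step : ∀ {x y z k} → x ⊑ y → x ≢ y → Path y z k → Path x z (suc k)

_++ₚ_ : ∀ {n j k} {x y z : Cube n} → Path x y j → Path y z k → Path x z (j + k)
[]             ++ₚ q = q
step x⊑y x≢y p ++ₚ q = step x⊑y x≢y (p ++ₚ q)

path-∷ : ∀ {n k} {x y : Cube n} b → Path x y k → Path (b ∷ x) (b ∷ y) k
path-∷ b []               = []
path-∷ b (step x⊑y x≢y p) = step (b≤b ∷ x⊑y) (x≢y ∘ Vecₚ.∷-injectiveʳ) (path-∷ b p)

-- Raise the differing coordinates one at a time; each raise adds one to the weight, which fixes the
-- length.
⊑-path : ∀ {n} {x y : Cube n} → x ⊑ y → ∃ λ k → Path x y k × k + weight x ≡ weight y
⊑-path []                       = 0 , [] , refl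
⊑-path {x = false ∷ _} (b≤b ∷ x⊑y) with k , p , eq ← ⊑-path x⊑y = k , path-∷ false p , eq
⊑-path {x = true ∷ x}  (b≤b ∷ x⊑y) with k , p , eq ← ⊑-path x⊑y =
  k , path-∷ true p , trans (ℕₚ.+-suc k (weight x)) (cong suc eq)
⊑-path (f≤t ∷ x⊑y) with k , p , eq ← ⊑-path x⊑y =
  suc k , step (f≤t ∷ ⊑-refl) (λ ()) (path-∷ true p) , cong suc eq

change : Bool → Bool → ℕ
change a b = if a xor b then 1 else 0

change-triangle : ∀ a b c → change a c ≤ change a b + change b c
change-triangle false false c     = ℕₚ.≤-refl
change-triangle true  true  c     = ℕₚ.≤-refl
change-triangle false true  false = z≤n
change-triangle false true  true  = s≤s z≤n
change-triangle true  false false = s≤s z≤n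
change-triangle true  false true  = z≤n

change-not : ∀ b → change b (not b) ≡ 1
change-not false = refl
change-not true  = refl

change-same : ∀ b → change b b ≡ 0
change-same b = cong (if_then 1 else 0) (xor-same b)

points : ∀ {n k} {x y : Cube n} → Path x y k → Fin (suc k) → Cube n
points {x = x} p            zero    = x
points         (step _ _ p) (suc i) = points p i

points-last : ∀ {n k} {x y : Cube n} (p : Path x y k) → points p (fromℕ k) ≡ y
points-last []           = refl
points-last (step _ _ p) = points-last p

points-step : ∀ {n k} {x y : Cube n} (p : Path x y k) (i : Fin k) →
  points p (inject₁ i) ⊑ points p (suc i) × points p (inject₁ i) ≢ points p (suc i)
points-step (step x⊑y x≢y p) zero    = x⊑y , x≢y
points-step (step _   _   p) (suc i) = points-step p i

path-chain : ∀ {n} → Path {n} zeros ones n → Chain n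
path-chain p = record
  { pt = points p; start = refl; end = points-last p
  ; step-≼ = λ i → Pointwise.lookup (proj₁ (points-step p i))
  ; step-≢ = λ i → proj₂ (points-step p i) }

module _ {n} (f : BoolFun n) where

  pathSwitches : ∀ {k} {x y : Cube n} → Path x y k → ℕ
  pathSwitches {k} p = sumFin {k} (λ i → change (f (points p (inject₁ i))) (f (points p (suc i))))

  sumFin-suc : ∀ {k} (g : Fin (suc k) → ℕ) → sumFin g ≡ g zero + sumFin (g ∘ suc)
  sumFin-suc g = cong (λ xs → g zero + List.foldr _+_ 0 xs)
    (trans (Listₚ.map-tabulate suc g) (sym (Listₚ.map-tabulate id (g ∘ suc))))

  pathSwitches-step : ∀ {k} {x y z : Cube n} (x⊑y : x ⊑ y) (x≢y : x ≢ y) (p : Path y z k) →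
    pathSwitches (step x⊑y x≢y p) ≡ change (f x) (f y) + pathSwitches p
  pathSwitches-step {k} {x} x⊑y x≢y p =
    sumFin-suc {k} (λ i → change (f (points (step x⊑y x≢y p) (inject₁ i))) (f (points p i)))

  pathSwitches-++ : ∀ {j k} {x y z : Cube n} (p : Path x y j) (q : Path y z k) →
    pathSwitches (p ++ₚ q) ≡ pathSwitches p + pathSwitches q
  pathSwitches-++ []                       q = refl
  pathSwitches-++ (step {x} {y} x⊑y x≢y p) q = begin
    pathSwitches (step x⊑y x≢y (p ++ₚ q))                       ≡⟨ pathSwitches-step x⊑y x≢y (p ++ₚ q) ⟩
    change (f x) (f y) + pathSwitches (p ++ₚ q)                 ≡⟨ cong (change (f x) (f y) +_) (pathSwitches-++ p q) ⟩
    change (f x) (f y) + (pathSwitches p + pathSwitches q)      ≡⟨ ℕₚ.+-assoc (change (f x) (f y)) _ _ ⟨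
    change (f x) (f y) + pathSwitches p + pathSwitches q        ≡⟨ cong (_+ pathSwitches q) (pathSwitches-step x⊑y x≢y p) ⟨
    pathSwitches (step x⊑y x≢y p) + pathSwitches q              ∎
    where open ≡-Reasoning

  -- The triangle inequality along a path: refining a jump never loses a change of value.
  change-path : ∀ {k} {x y : Cube n} b (p : Path x y k) → change b (f y) ≤ change b (f x) + pathSwitches p
  change-path b []                       = ℕₚ.m≤m+n _ 0
  change-path {y = z} b (step {x} {y} x⊑y x≢y p) = begin
    change b (f z)                                        ≤⟨ change-path b p ⟩
    change b (f y) + pathSwitches p                       ≤⟨ ℕₚ.+-monoˡ-≤ _ (change-triangle b (f x) (f y)) ⟩
    change b (f x) + change (f x) (f y) + pathSwitches p  ≡⟨ ℕₚ.+-assoc (change b (f x)) _ _ ⟩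
    change b (f x) + (change (f x) (f y) + pathSwitches p) ≡⟨ cong (change b (f x) +_) (pathSwitches-step x⊑y x≢y p) ⟨
    change b (f x) + pathSwitches (step x⊑y x≢y p)        ∎
    where open ℕₚ.≤-Reasoning

  -- Refine every jump into single-coordinate steps and continue up to `ones`. The term
  -- `change b (f x)` pays for a nominal starting value b that differs from `f x`.
  climb-path : ∀ {b x k} → Climb f b x k → ∃ λ j → Σ (Path x ones j) λ p →
    j + weight x ≡ n × k ≤ change b (f x) + pathSwitches p
  climb-path {x = x} done with j , p , eq ← ⊑-path (⊑-ones x) = j , p , trans eq (weight-ones n) , z≤n
  climb-path {b} {x} {suc k} (step {y = y} x⊑y fy climb)
    with i , p , eq-p ← ⊑-path x⊑y | j , q , eq-q , k≤ ← climb-path climb = i + j , p ++ₚ q , eq , (begin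
    1 + k                                               ≤⟨ ℕₚ.+-monoʳ-≤ 1 k≤ ⟩
    1 + (change (not b) (f y) + pathSwitches q)         ≡⟨ cong (λ a → 1 + (change (not b) a + pathSwitches q)) fy ⟩
    1 + (change (not b) (not b) + pathSwitches q)       ≡⟨ cong (λ a → 1 + (a + pathSwitches q)) (change-same (not b)) ⟩
    1 + pathSwitches q                                  ≡⟨ cong (_+ pathSwitches q) (change-not b) ⟨
    change b (not b) + pathSwitches q                   ≡⟨ cong (λ a → change b a + pathSwitches q) fy ⟨
    change b (f y) + pathSwitches q                     ≤⟨ ℕₚ.+-monoˡ-≤ _ (change-path b p) ⟩
    change b (f x) + pathSwitches p + pathSwitches q    ≡⟨ ℕₚ.+-assoc (change b (f x)) _ _ ⟩
    change b (f x) + (pathSwitches p + pathSwitches q)  ≡⟨ cong (change b (f x) +_) (pathSwitches-++ p q) ⟨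
    change b (f x) + pathSwitches (p ++ₚ q)             ∎)
    where
    open ℕₚ.≤-Reasoning
    eq : i + j + weight x ≡ n
    eq = trans (cong (_+ weight x) (ℕₚ.+-comm i j))
      (trans (ℕₚ.+-assoc j i (weight x)) (trans (cong (j +_) eq-p) eq-q))

  altBound : ∀ {K} → AltAtMost f K → AltBound f K
  altBound {K} alt {k} climb with j , p , eq , k≤ ← climb-path climb = bounded j p j≡n k≤
    where
    j≡n : j ≡ n
    j≡n = trans (sym (trans (cong (j +_) (weight-zeros n)) (ℕₚ.+-identityʳ j))) eq
    -- The length is kept general so that matching on `j ≡ n` gives p the type that `path-chain`
    -- expects.
    bounded : ∀ j (p : Path zeros ones j) → j ≡ n → k ≤ change (f zeros) (f zeros) + pathSwitches p → k ≤ K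
    bounded _ p refl k≤ = ℕₚ.≤-trans k≤
      (ℕₚ.≤-trans (ℕₚ.≤-reflexive (cong (_+ pathSwitches p) (change-same (f zeros)))) (alt (path-chain p)))

-- Logarithms

n<2^[1+⌊log₂n⌋] : ∀ n → n < 2 ^ suc ⌊log₂ n ⌋
n<2^[1+⌊log₂n⌋] n = ℕₚ.≰⇒> λ large → ℕₚ.<-irrefl refl (begin-strict
  ⌊log₂ n ⌋                    <⟨ ℕₚ.n<1+n _ ⟩
  suc ⌊log₂ n ⌋                ≡⟨ ⌊log₂[2^n]⌋≡n _ ⟨
  ⌊log₂ 2 ^ suc ⌊log₂ n ⌋ ⌋    ≤⟨ ⌊log₂⌋-mono-≤ large ⟩
  ⌊log₂ n ⌋                    ∎)
  where open ℕₚ.≤-Reasoning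

2^⌈log₂n⌉≤2n : ∀ n → 0 < n → 2 ^ ⌈log₂ n ⌉ ≤ 2 * n
2^⌈log₂n⌉≤2n n n>0 with ⌈log₂ n ⌉ in eq
... | zero  = ℕₚ.≤-trans n>0 (ℕₚ.m≤n*m n 2)
... | suc e = ℕₚ.*-monoʳ-≤ 2 {2 ^ e} {n} (ℕₚ.<⇒≤ (ℕₚ.≰⇒> λ n≤2^e → ℕₚ.<-irrefl refl (begin-strict
  e              <⟨ ℕₚ.n<1+n e ⟩
  suc e          ≡⟨ eq ⟨
  ⌈log₂ n ⌉      ≤⟨ ⌈log₂⌉-mono-≤ n≤2^e ⟩
  ⌈log₂ 2 ^ e ⌉  ≡⟨ ⌈log₂2^n⌉≡n e ⟩
  e              ∎)))
  where open ℕₚ.≤-Reasoning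

-- An odd subcube of this dimension would need more characters than `odd-subcube` leaves room for.
-- The 2 is one for the strict degree bound and one for rounding the logarithm down.
degree-sparsity : ∀ {n} (f : BoolFun n) → Degree< (2 + ⌊log₂ sparsity f ⌋) f
degree-sparsity f ρ large with parity f ρ in eq
... | false = refl
... | true  = contradiction (ℕₚ.^-monoʳ-< 2 (s≤s (s≤s z≤n)) (ℕₚ.n<1+n (suc ⌊log₂ sparsity f ⌋))) (ℕₚ.≤⇒≯ (begin
  2 ^ (2 + ⌊log₂ sparsity f ⌋)   ≤⟨ ℕₚ.^-monoʳ-≤ 2 large ⟩
  2 ^ dim ρ                      ≤⟨ odd-subcube f ρ eq ⟩
  sparsity f + 1                 ≡⟨ ℕₚ.+-comm _ 1 ⟩
  suc (sparsity f)               ≤⟨ n<2^[1+⌊log₂n⌋] (sparsity f) ⟩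
  2 ^ suc ⌊log₂ sparsity f ⌋     ∎))
  where open ℕₚ.≤-Reasoning

^-distribʳ-* : ∀ o m n → (m * n) ^ o ≡ m ^ o * n ^ o
^-distribʳ-* zero    m n = refl
^-distribʳ-* (suc o) m n = trans (cong (m * n *_) (^-distribʳ-* o m n)) (*-interchange m n (m ^ o) (n ^ o))

1+n≤2^n : ∀ n → suc n ≤ 2 ^ n
1+n≤2^n zero    = s≤s z≤n
1+n≤2^n (suc n) = begin
  suc (suc n)      ≤⟨ s≤s (1+n≤2^n n) ⟩
  1 + 2 ^ n        ≤⟨ ℕₚ.+-monoˡ-≤ (2 ^ n) (ℕₚ.m^n>0 2 n) ⟩
  2 ^ n + 2 ^ n    ≡⟨ cong (2 ^ n +_) (ℕₚ.+-identityʳ _) ⟨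
  2 ^ suc n        ∎
  where open ℕₚ.≤-Reasoning

2^-cancel-≤ : ∀ {m n} → 2 ^ m ≤ 2 ^ n → m ≤ n
2^-cancel-≤ {m} {n} le = ℕₚ.≮⇒≥ λ n<m → ℕₚ.<⇒≱ (ℕₚ.^-monoʳ-< 2 (s≤s (s≤s z≤n)) n<m) le

-- The sum of the coefficients in the estimate 2 (A + suc l) + 2 c of `exponent-bound`, where A = 2
-- ((2 c)^c + 2).
logBound : ℕ → ℕ
logBound c = 2 * (2 * ((2 * c) ^ c + 2)) + 2 + 2 * c

-- With t = e / 2c, e ^ c is at most a constant times 2 ^ (t c), roughly the square root of 2 ^ e.
exponent-bound : ∀ c → 0 < c → ∀ {e n s l} → 2 ^ e ≤ 2 * n → n ≤ (2 + e ^ c) * s → s ≤ 2 ^ suc l →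
  e ≤ logBound c * suc l
exponent-bound c c>0 {e} {n} {s} {l} 2^e≤2n n≤ s≤ = begin
  e                              ≤⟨ e≤ ⟩
  q * suc t                      ≡⟨ regroup c t ⟩
  2 * (t * c) + q                ≤⟨ ℕₚ.+-monoˡ-≤ q (ℕₚ.*-monoʳ-≤ 2 tc≤) ⟩
  -- The added term completes the constants to multiples of `suc l`.
  2 * (A + suc l) + q            ≤⟨ ℕₚ.m≤m+n _ ((2 * A + 2 * c) * l) ⟩
  2 * (A + suc l) + q + (2 * A + 2 * c) * l ≡⟨ expand A c l ⟩
  logBound c * suc l             ∎
  where
  open ℕₚ.≤-Reasoning
  q = 2 * c
  instance
    q≢0 : NonZero q
    q≢0 = >-nonZero (ℕₚ.≤-trans c>0 (ℕₚ.m≤n*m c 2))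
  t = e / q
  A = 2 * (q ^ c + 2)
  regroup : ∀ c t → 2 * c * suc t ≡ 2 * (t * c) + 2 * c
  regroup = ℕ-solve-∀
  expand : ∀ A c l → 2 * (A + suc l) + 2 * c + (2 * A + 2 * c) * l ≡ (2 * A + 2 + 2 * c) * suc l
  expand = ℕ-solve-∀
  e≤ : e ≤ q * suc t
  e≤ = begin
    e                    ≡⟨ m≡m%n+[m/n]*n e q ⟩
    e % q + t * q        ≤⟨ ℕₚ.+-monoˡ-≤ (t * q) (ℕₚ.<⇒≤ (m%n<n e q)) ⟩
    q + t * q            ≡⟨ ℕₚ.*-comm (suc t) q ⟩
    q * suc t            ∎
  tq≤e : t * q ≤ e
  tq≤e = ℕₚ.≤-trans (ℕₚ.m≤n+m (t * q) (e % q)) (ℕₚ.≤-reflexive (sym (m≡m%n+[m/n]*n e q)))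
  e^c≤ : e ^ c ≤ q ^ c * 2 ^ (t * c)
  e^c≤ = begin
    e ^ c                  ≤⟨ ℕₚ.^-monoˡ-≤ c e≤ ⟩
    (q * suc t) ^ c        ≡⟨ ^-distribʳ-* c q (suc t) ⟩
    q ^ c * suc t ^ c      ≤⟨ ℕₚ.*-monoʳ-≤ (q ^ c) (ℕₚ.^-monoˡ-≤ c (1+n≤2^n t)) ⟩
    q ^ c * (2 ^ t) ^ c    ≡⟨ cong (q ^ c *_) (ℕₚ.^-*-assoc 2 t c) ⟩
    q ^ c * 2 ^ (t * c)    ∎
  p = 2 ^ (t * c)
  2+e^c≤ : 2 + e ^ c ≤ (q ^ c + 2) * p
  2+e^c≤ = begin
    2 + e ^ c              ≤⟨ ℕₚ.+-mono-≤ (ℕₚ.*-monoʳ-≤ 2 (ℕₚ.m^n>0 2 (t * c))) e^c≤ ⟩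
    2 * p + q ^ c * p      ≡⟨ factor (q ^ c) p ⟩
    (q ^ c + 2) * p        ∎
    where
    factor : ∀ a p → 2 * p + a * p ≡ (a + 2) * p
    factor = ℕ-solve-∀
  -- With t c about e / 2, p squared is at most 2 ^ e, while 2 + e ^ c contributes only one factor
  -- p. Cancelling it bounds p itself.
  square : p * p ≤ p * (A * 2 ^ suc l)
  square = begin
    p * p                                   ≡⟨ ℕₚ.^-distribˡ-+-* 2 (t * c) (t * c) ⟨
    2 ^ (t * c + t * c)                     ≡⟨ cong (2 ^_) (double t c) ⟩
    2 ^ (t * q)                             ≤⟨ ℕₚ.^-monoʳ-≤ 2 tq≤e ⟩
    2 ^ e                                   ≤⟨ 2^e≤2n ⟩
    2 * n                                   ≤⟨ ℕₚ.*-monoʳ-≤ 2 n≤ ⟩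
    2 * ((2 + e ^ c) * s)                   ≤⟨ ℕₚ.*-monoʳ-≤ 2 (ℕₚ.*-mono-≤ 2+e^c≤ s≤) ⟩
    2 * ((q ^ c + 2) * p * 2 ^ suc l)       ≡⟨ rotate (q ^ c) p (2 ^ suc l) ⟩
    p * (A * 2 ^ suc l)                     ∎
    where
    double : ∀ t c → t * c + t * c ≡ t * (2 * c)
    double = ℕ-solve-∀
    rotate : ∀ a p r → 2 * ((a + 2) * p * r) ≡ p * (2 * (a + 2) * r)
    rotate = ℕ-solve-∀
  tc≤ : t * c ≤ A + suc l
  tc≤ = 2^-cancel-≤ (begin
    p                      ≤⟨ ℕₚ.*-cancelˡ-≤ p {{ℕₚ.m^n≢0 2 (t * c)}} square ⟩
    A * 2 ^ suc l          ≤⟨ ℕₚ.*-monoˡ-≤ (2 ^ suc l) (ℕₚ.<⇒≤ (1+n≤2^n A)) ⟩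
    2 ^ A * 2 ^ suc l      ≡⟨ ℕₚ.^-distribˡ-+-* 2 A (suc l) ⟨
    2 ^ (A + suc l)        ∎)

theorem3 : (c : ℕ) → 0 < c →
    Σ ℕ λ C → Σ ℕ λ d → Σ ℕ λ n₀ → 0 < C × 0 < d ×
    ((n : ℕ) → n₀ ≤ n → (f : BoolFun n) → DependsOnAll f →
    AltAtMost f (⌈log₂ n ⌉ ^ c) →
    XorCCAtMost f (C * (1 + ⌊log₂ sparsity f ⌋) ^ d))
-- With m = 1 + ⌊log₂ s⌋ the tree has height m * (K * m) and each query costs two bits. Since K is
-- at most M ^ c * m ^ c, the exponent is 2 + c. The threshold 1 makes n positive for the bound on
-- ⌈log₂ n⌉.
theorem3 c c>0 = 2 * M ^ c , 2 + c , 1 , C>0 , s≤s z≤n , bound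
  where
  M = logBound c
  C>0 : 0 < 2 * M ^ c
  C>0 = ℕₚ.≤-trans (ℕₚ.m^n>0 M {{>-nonZero M>0}} c) (ℕₚ.m≤n*m (M ^ c) 2)
    where
    M>0 : 0 < M
    M>0 = ℕₚ.≤-trans c>0 (ℕₚ.≤-trans (ℕₚ.m≤n*m c 2) (ℕₚ.m≤n+m (2 * c) (2 * (2 * ((2 * c) ^ c + 2)) + 2)))
  bound : ∀ n → 1 ≤ n → (f : BoolFun n) → DependsOnAll f → AltAtMost f (⌈log₂ n ⌉ ^ c) →
    XorCCAtMost f (2 * M ^ c * (1 + ⌊log₂ sparsity f ⌋) ^ (2 + c))
  bound n n>0 f dep alt = weaken (decides-CC (decision m K f (degree-sparsity f) alternation))
    where
    m = suc ⌊log₂ sparsity f ⌋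
    K = ⌈log₂ n ⌉ ^ c
    alternation : AltBound f K
    alternation = altBound f alt
    e≤ : ⌈log₂ n ⌉ ≤ M * m
    e≤ = exponent-bound c c>0 (2^⌈log₂n⌉≤2n n n>0) (dependent-bound f {K} dep alternation)
      (ℕₚ.<⇒≤ (n<2^[1+⌊log₂n⌋] (sparsity f)))
    K≤ : K ≤ M ^ c * m ^ c
    K≤ = ℕₚ.≤-trans (ℕₚ.^-monoˡ-≤ c e≤) (ℕₚ.≤-reflexive (^-distribʳ-* c M m))
    rearrange : ∀ m a b → 2 * (m * (a * b * m)) ≡ 2 * a * (m * (m * b))
    rearrange = ℕ-solve-∀
    total : 2 * (m * (K * m)) ≤ 2 * M ^ c * m ^ (2 + c)
    total = ℕₚ.≤-trans (ℕₚ.*-monoʳ-≤ 2 (ℕₚ.*-monoʳ-≤ m (ℕₚ.*-monoˡ-≤ m K≤)))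
      (ℕₚ.≤-reflexive (rearrange m (M ^ c) (m ^ c)))
    weaken : XorCCAtMost f (2 * (m * (K * m))) → XorCCAtMost f (2 * M ^ c * m ^ (2 + c))
    weaken (P , depth≤ , correct) = P , ℕₚ.≤-trans depth≤ total , correct
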